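{- Let $\alpha$, $\beta$, $\sigma$ be nonempty consecutive patterns. If $\alpha$ and $\beta$ are Wilf-equivalent, then $\alpha\oplus\sigma$ and $\beta\oplus\sigma$ are filling-shape-Wilf-equivalent.
   Context: A vincular pattern of length $k$ is a pair $(\sigma,X)$ with $\sigma\in S_k$ and $X\subseteq[k-1]$. It is consecutive if $X=[k-1]$. Direct sum: $(\sigma,A)\oplus(\tau,B)=(\sigma_1\cdots\sigma_k(\tau_1+k)\cdots(\tau_\ell+k),\ A\cup\{i+k:i\in B\})$, where $k$ is the length of $\sigma$ and $\ell$ that of $\tau$. Thus $\alpha\oplus\sigma$ has a single dash, between its $\alpha$-part and its $\sigma$-part. A permutation $\pi\in S_n$ contains $(\sigma,X)$ if there are $i_1<\dots<i_k$ with $\pi_{i_1}\cdots\pi_{i_k}$ order-isomorphic to $\sigma$ and $i_{j+1}=i_j+1$ for all $j\in X$. Two patterns are Wilf-equivalent if, for every $n$, equally many permutations of $S_n$ avoid each. A Young board $\lambda=(\lambda_1,\dots,\lambda_n)$ with $\lambda_1\ge\dots\ge\lambda_n>0$ is the cell set $\{(i,j):1\le i\le n,\ 1\le j\le\lambda_i\}$, with width $n$ and height $\lambda_1$. A filling is a $0/1$ assignment to the cells with at most one $1$ per row and per column. It is encoded by the word $\pi_1\cdots\pi_n$ with $\pi_c=r$ if $(c,r)$ holds a $1$ and $\pi_c=\square$ if column $c$ is empty. A filling $\pi$ contains $(\sigma,X)$ if there are $i_1<\dots<i_k$ such that all of the following hold: - all $\pi_{i_j}$ are numbers; - $\pi_{i_1}\cdots\pi_{i_k}$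 is order-isomorphic to $\sigma$; - $i_{j+1}=i_j+1$ for $j\in X$; - the cell $(i_k,\max_j\pi_{i_j})$ lies in $\lambda$. Otherwise $\pi$ avoids $(\sigma,X)$. $\mathcal{S}_\lambda^{C,R}(\sigma)$ denotes the set of fillings of $\lambda$ with empty columns exactly $C$ and empty rows exactly $R$ that avoid $\sigma$. Patterns $\sigma,\tau$ are filling-shape-Wilf-equivalent if $|\mathcal{S}_\lambda^{C,R}(\sigma)|=|\mathcal{S}_\lambda^{C,R}(\tau)|$ for all Young boards $\lambda$ and all $C\subseteq[\text{width}(\lambda)]$, $R\subseteq[\text{height}(\lambda)]$. -}

module Defs where

open import Data.Nat using (ℕ; zero; suc; _+_; _∸_; _≤_; _<_; _⊔_)
open import Data.List using (List; []; _∷_; _++_; map; length; upTo)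
open import Data.List.Relation.Unary.All using (All)
open import Data.List.Relation.Unary.Linked using (Linked)
open import Data.List.Relation.Unary.Unique.Propositional using (Unique)
open import Data.List.Membership.Propositional using (_∈_)
open import Data.List.Relation.Binary.Permutation.Propositional using (_↭_)
open import Data.Maybe using (Maybe; just; nothing)
open import Data.Product using (Σ; ∃; _×_; _,_)
open import Relation.Binary.PropositionalEquality using (_≡_)
open import Relation.Nullary using (¬_)
open import Function.Bundles using (_⇔_)

infixl 20 _‼_ _!_
-- 1-indexed access into a word over ℕ ∪ {□} (□ = nothing):
-- w ‼ c is the c-th letter (c ≥ 1); also nothing if c is out of range.
_‼_ : List (Maybe ℕ) → ℕ → Maybe ℕ
[] ‼ _ = nothing
(x ∷ xs) ‼ zero = nothing
(x ∷ xs) ‼ suc zero = x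
(x ∷ xs) ‼ suc (suc n) = xs ‼ suc n

-- 1-indexed access into a list of naturals (default 0 outside [1, length]).
_!_ : List ℕ → ℕ → ℕ
[] ! _ = 0
(x ∷ xs) ! zero = 0
(x ∷ xs) ! suc zero = x
(x ∷ xs) ! suc (suc n) = xs ! suc n

oneTo : ℕ → List ℕ
oneTo m = map suc (upTo m)

maxTo : (ℕ → ℕ) → ℕ → ℕ
maxTo v zero = 0
maxTo v (suc k) = v (suc k) ⊔ maxTo v k

HasCard : {A : Set} → (A → Set) → ℕ → Set
HasCard {A} P m =
  Σ (List A) λ L → Unique L × (∀ x → (x ∈ L) ⇔ P x) × length L ≡ m

Equinumerous : {A : Set} → (A → Set) → (A → Set) → Set
Equinumerous P Q = Σ ℕ λ m → HasCard P m × HasCard Q m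

IsPerm : ℕ → List ℕ → Set
IsPerm n π = π ↭ oneTo n

-- A vincular pattern (σ , X): σ in one-line notation, X ⊆ [k-1] as a list.
record VPattern : Set where
  constructor vpat
  field
    perm   : List ℕ
    dashes : List ℕ   -- the set X (adjacency-required positions)
open VPattern public

consecutive : List ℕ → VPattern
consecutive σ = vpat σ (oneTo (length σ ∸ 1))

_⊕_ : VPattern → VPattern → VPattern
vpat σ A ⊕ vpat τ B = vpat (σ ++ map (_+ length σ) τ) (A ++ map (_+ length σ) B)

-- i j is the position i_j, and v j the value π_{i_j}, for 1 ≤ j ≤ k.
record Occurrence (w : List (Maybe ℕ)) (p : VPattern) (i v : ℕ → ℕ) : Set where
  field
    -- all π_{i_j} are numbers (in particular 1 ≤ i_j ≤ length w), with value v j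
    values     : ∀ j → 1 ≤ j → j ≤ length (perm p) → w ‼ (i j) ≡ just (v j)
    increasing : ∀ j → 1 ≤ j → j < length (perm p) → i j < i (suc j)
    orderIso   : ∀ a b → 1 ≤ a → a ≤ length (perm p) → 1 ≤ b → b ≤ length (perm p) →
                 (v a < v b) ⇔ (perm p ! a < perm p ! b)
    adjacent   : ∀ j → j ∈ dashes p → i (suc j) ≡ suc (i j)

PermContains : List ℕ → VPattern → Set
PermContains π p = Σ (ℕ → ℕ) λ i → Σ (ℕ → ℕ) λ v → Occurrence (map just π) p i v

WilfEquivalent : VPattern → VPattern → Set
WilfEquivalent p q =
  ∀ n → Equinumerous (λ π → IsPerm n π × ¬ PermContains π p)
                     (λ π → IsPerm n π × ¬ PermContains π q)

YoungBoard : List ℕ → Set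
YoungBoard λs = Linked (λ a b → b ≤ a) λs × All (λ x → 0 < x) λs

width : List ℕ → ℕ
width = length

height : List ℕ → ℕ
height [] = 0
height (x ∷ _) = x

InBoard : List ℕ → ℕ → ℕ → Set
InBoard λs c r = 1 ≤ c × c ≤ width λs × 1 ≤ r × r ≤ λs ! c

-- π (a word over ℕ ∪ {□}) encodes a filling of λ with empty columns exactly C
-- and empty rows exactly R.
record FillingCR (λs : List ℕ) (C R : List ℕ) (π : List (Maybe ℕ)) : Set where
  field
    len       : length π ≡ width λs
    inBoard   : ∀ c r → π ‼ c ≡ just r → InBoard λs c r
    rowUnique : ∀ c c′ r → π ‼ c ≡ just r → π ‼ c′ ≡ just r → c ≡ c′
    emptyCols : ∀ c → 1 ≤ c → c ≤ width λs → (π ‼ c ≡ nothing) ⇔ (c ∈ C)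
    emptyRows : ∀ r → 1 ≤ r → r ≤ height λs → (¬ ∃ λ c → π ‼ c ≡ just r) ⇔ (r ∈ R)

FillContains : List ℕ → List (Maybe ℕ) → VPattern → Set
FillContains λs π p =
  Σ (ℕ → ℕ) λ i → Σ (ℕ → ℕ) λ v →
    Occurrence π p i v × InBoard λs (i (length (perm p))) (maxTo v (length (perm p)))

S : List ℕ → List ℕ → List ℕ → VPattern → List (Maybe ℕ) → Set
S λs C R p π = FillingCR λs C R π × ¬ FillContains λs π p

FSWilfEquivalent : VPattern → VPattern → Set
FSWilfEquivalent p q =
  ∀ λs → YoungBoard λs →
  ∀ C R → All (λ c → 1 ≤ c × c ≤ width λs) C → All (λ r → 1 ≤ r × r ≤ height λs) R →
  Equinumerous (S λs C R p) (S λs C R q)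

{-# OPTIONS --safe #-}

-- Call a cell covered if some occurrence of σ inside the board lies strictly to its right and above
-- it.  The covered cells form a Young board, and a filling contains α ⊕ σ iff α occurs in consecutive
-- columns whose entries, and whose upper right corner, are covered.  If the entries in columns c and
-- c + 1 are covered, then so is the cell in column c + 1 in the row of the former: an occurrence of σ
-- starting in column c + 1 has a covered first entry, hence can be replaced by a later one.  So on a
-- maximal run of consecutive columns with covered entries every cell in the columns and rows of the
-- run is covered, and avoiding α ⊕ σ just means that each run avoids α.  Rearranging the entries of
-- each run by a bijection between α-avoiders and β-avoiders does not change the covered cells, as
-- these are determined by the occurrences of σ that consist of uncovered entries; so the exchange is
-- invertible.
module Submission where

open import Defs
open import Data.Empty using (⊥-elim)
open import Data.List using (List; []; _∷_; _++_; map; length; filter; deduplicate; cartesianProductWith)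
import Data.List.Membership.DecPropositional as DecMembership
open import Data.List.Membership.Propositional using (_∈_)
open import Data.List.Membership.Propositional.Properties
  using (∈-map⁺; ∈-map⁻; ∈-upTo⁺; ∈-upTo⁻; ∈-++⁺ˡ; ∈-++⁺ʳ; ∈-++⁻; ∈-filter⁺; ∈-filter⁻; ∈-deduplicate⁺; ∈-cartesianProductWith⁺)
open import Data.List.Properties using (length-++; length-map; map-cong-local; map-id-local; map-∘; map-upTo)
import Data.List.Properties as List
open import Data.List.Relation.Binary.Permutation.Propositional
  using (_↭_; prep; ↭-sym; ↭-trans; ↭-reflexive; ↭⇒↭ₛ)
open import Data.List.Relation.Binary.Permutation.Propositional.Properties using (∈-resp-↭; ↭-length; ++⁺; map⁺)
import Data.List.Relation.Binary.Permutation.Setoid.Properties as Permₛ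
open import Data.List.Relation.Binary.Pointwise using (Pointwise-≡⇒≡)
open import Data.List.Relation.Unary.All using (All; []; _∷_)
import Data.List.Relation.Unary.All as All
open import Data.List.Relation.Unary.AllPairs using (AllPairs; []; _∷_)
import Data.List.Relation.Unary.AllPairs as AllPairs
open import Data.List.Relation.Unary.Any using (here; there)
open import Data.List.Relation.Unary.Linked using (Linked; _∷_)
open import Data.List.Relation.Unary.Linked.Properties using (Linked⇒AllPairs)
open import Data.List.Relation.Unary.Sorted.TotalOrder.Properties using (↗↭↗⇒≋)
open import Data.List.Relation.Unary.Unique.DecPropositional.Properties using (deduplicate-!)
open import Data.List.Relation.Unary.Unique.Propositional using (Unique)
open import Data.List.Relation.Unary.Unique.Propositional.Properties using (Unique[x∷xs]⇒x∉xs)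
  renaming (filter⁺ to Unique-filter⁺)
open import Data.Maybe using (Maybe; just; nothing; fromMaybe)
open import Data.Maybe.Properties using (just-injective; ≡-dec)
open import Data.Nat using (ℕ; zero; suc; _+_; _∸_; _≤_; _<_; z≤n; s≤s; z<s; s≤s⁻¹; _≤?_; _<?_; _≟_)
open import Data.Nat.Properties
open import Data.List.Sort ≤-decTotalOrder using (sort; sort-↭; sort-↗)
open import Data.Product using (Σ; ∃; _×_; _,_; proj₁; proj₂)
open import Data.Sum using (_⊎_; inj₁; inj₂)
open import Function using (_∘_; case_of_)
open import Function.Bundles using (_⇔_; mk⇔; module Equivalence)
open import Relation.Binary.Definitions using (tri<; tri≈; tri>; DecidableEquality)
open import Relation.Binary.PropositionalEquality
open import Relation.Nullary using (¬_; Dec; yes; no)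
open import Relation.Nullary.Decidable using (map′; _×-dec_; _→-dec_; ¬?)
open Equivalence using (to; from)
open FillingCR

-- Words and occurrences

infix 4 _∈₁_
_∈₁_ : ℕ → ℕ → Set
j ∈₁ n = 1 ≤ j × j ≤ n

∈-oneTo⁺ : ∀ {j n} → j ∈₁ n → j ∈ oneTo n
∈-oneTo⁺ {suc j} (_ , j<n) = ∈-map⁺ suc (∈-upTo⁺ j<n)

∈-oneTo⁻ : ∀ {j n} → j ∈ oneTo n → j ∈₁ n
∈-oneTo⁻ j∈ with ∈-map⁻ suc j∈
... | i , i∈ , refl = s≤s z≤n , ∈-upTo⁻ i∈

all₁? : {P : ℕ → Set} → (∀ j → Dec (P j)) → ∀ n → Dec (∀ j → j ∈₁ n → P j)
all₁? P? n = map′ (λ { f (suc j) (_ , j<n) → f j<n }) (λ f {j} j<n → f (suc j) (s≤s z≤n , j<n))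
                  (allUpTo? (P? ∘ suc) n)

-- Later it asks whether an occurrence meets a column that may have changed. At each index it
-- suffices to know one of the two alternatives; neither has to be decidable.
choose₁ : {P Q : ℕ → Set} → (∀ j → P j ⊎ Q j) → ∀ n → (∃ λ j → j ∈₁ n × P j) ⊎ (∀ j → j ∈₁ n → Q j)
choose₁ h zero = inj₂ λ { _ (s≤s _ , ()) }
choose₁ h (suc n) with h (suc n) | choose₁ h n
... | inj₁ p | _ = inj₁ (suc n , (z<s , ≤-refl) , p)
... | inj₂ q | inj₁ (j , (1≤j , j≤n) , p) = inj₁ (j , (1≤j , m≤n⇒m≤1+n j≤n) , p)
... | inj₂ q | inj₂ qs = inj₂ λ j (1≤j , j≤) → case m≤n⇒m<n∨m≡n j≤ of λ where
  (inj₁ (s≤s j≤n)) → qs j (1≤j , j≤n)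
  (inj₂ refl) → q

infix 3 _⇔?_
_⇔?_ : {A B : Set} → Dec A → Dec B → Dec (A ⇔ B)
A? ⇔? B? = map′ (λ (f , g) → mk⇔ f g) (λ e → to e , from e) ((A? →-dec B?) ×-dec (B? →-dec A?))

‼-bounds : ∀ w {c r} → w ‼ c ≡ just r → c ∈₁ length w
‼-bounds (x ∷ w) {suc zero} eq = s≤s z≤n , s≤s z≤n
‼-bounds (x ∷ w) {suc (suc c)} eq = s≤s z≤n , s≤s (proj₂ (‼-bounds w eq))

!-∈ : ∀ xs {j} → j ∈₁ length xs → xs ! j ∈ xs
!-∈ (x ∷ xs) {suc zero} _ = here refl
!-∈ (x ∷ xs) {suc (suc j)} (_ , s≤s j≤) = there (!-∈ xs (s≤s z≤n , j≤))

∈-! : ∀ {x xs} → x ∈ xs → ∃ λ j → j ∈₁ length xs × xs ! j ≡ x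
∈-! (here refl) = 1 , (s≤s z≤n , s≤s z≤n) , refl
∈-! (there x∈) with ∈-! x∈
... | suc j , (_ , j≤) , eq = suc (suc j) , (s≤s z≤n , s≤s j≤) , eq

!-++ˡ : ∀ xs {ys j} → j ∈₁ length xs → (xs ++ ys) ! j ≡ xs ! j
!-++ˡ (x ∷ xs) {j = suc zero} _ = refl
!-++ˡ (x ∷ xs) {j = suc (suc j)} (_ , s≤s j≤) = !-++ˡ xs (s≤s z≤n , j≤)

!-++ʳ : ∀ xs {ys j} → 1 ≤ j → (xs ++ ys) ! (j + length xs) ≡ ys ! j
!-++ʳ [] {ys} {j} _ = cong (ys !_) (+-identityʳ j)
!-++ʳ (x ∷ xs) {ys} {suc j} 1≤j rewrite +-suc j (length xs) = !-++ʳ xs {j = suc j} 1≤j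

!-map : ∀ (f : ℕ → ℕ) xs {j} → j ∈₁ length xs → map f xs ! j ≡ f (xs ! j)
!-map f (x ∷ xs) {suc zero} _ = refl
!-map f (x ∷ xs) {suc (suc j)} (_ , s≤s j≤) = !-map f xs (s≤s z≤n , j≤)

‼-map-just : ∀ xs {j} → j ∈₁ length xs → map just xs ‼ j ≡ just (xs ! j)
‼-map-just (x ∷ xs) {suc zero} _ = refl
‼-map-just (x ∷ xs) {suc (suc j)} (_ , s≤s j≤) = ‼-map-just xs (s≤s z≤n , j≤)

‼-++ˡ : ∀ xs {ys j} → j ∈₁ length xs → (xs ++ ys) ‼ j ≡ xs ‼ j
‼-++ˡ (x ∷ xs) {j = suc zero} _ = refl
‼-++ˡ (x ∷ xs) {j = suc (suc j)} (_ , s≤s j≤) = ‼-++ˡ xs (s≤s z≤n , j≤)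

‼-++ʳ : ∀ xs {ys j} → 1 ≤ j → (xs ++ ys) ‼ (length xs + j) ≡ ys ‼ j
‼-++ʳ [] _ = refl
‼-++ʳ (x ∷ []) {j = suc j} _ = refl
‼-++ʳ (x ∷ y ∷ xs) {j = j} 1≤j = ‼-++ʳ (y ∷ xs) {j = j} 1≤j

‼⇒∈ : ∀ w {c r} → w ‼ c ≡ just r → just r ∈ w
‼⇒∈ (x ∷ w) {suc zero} refl = here refl
‼⇒∈ (x ∷ w) {suc (suc c)} eq = there (‼⇒∈ w eq)

∈⇒‼ : ∀ {w r} → just r ∈ w → ∃ λ c → w ‼ c ≡ just r
∈⇒‼ (here refl) = 1 , refl
∈⇒‼ {x ∷ w} (there r∈) with ∈⇒‼ r∈
... | zero , eq = ⊥-elim (n≮0 (proj₁ (‼-bounds w eq)))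
... | suc c , eq = suc (suc c) , eq

IsPerm-bounds : ∀ {n π} → IsPerm n π → ∀ {x} → x ∈ π → x ∈₁ n
IsPerm-bounds perm x∈ = ∈-oneTo⁻ (∈-resp-↭ perm x∈)

maxTo-upper : ∀ v n {j} → j ∈₁ n → v j ≤ maxTo v n
maxTo-upper v zero (s≤s _ , ())
maxTo-upper v (suc n) {j} (1≤j , j≤) with m≤n⇒m<n∨m≡n j≤
... | inj₂ refl = m≤m⊔n _ _
... | inj₁ (s≤s j≤n) = ≤-trans (maxTo-upper v n (1≤j , j≤n)) (m≤n⊔m _ _)

maxTo-least : ∀ v n {x} → (∀ j → j ∈₁ n → v j ≤ x) → maxTo v n ≤ x
maxTo-least v zero _ = z≤n
maxTo-least v (suc n) h = ⊔-lub (h (suc n) (s≤s z≤n , ≤-refl))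
  (maxTo-least v n (λ j (1≤j , j≤n) → h j (1≤j , m≤n⇒m≤1+n j≤n)))

maxTo-attained : ∀ v n → 0 < n → ∃ λ j → j ∈₁ n × v j ≡ maxTo v n
maxTo-attained v (suc zero) _ = 1 , (s≤s z≤n , s≤s z≤n) , sym (⊔-identityʳ _)
maxTo-attained v (suc (suc n)) _ with maxTo-attained v (suc n) z<s
... | j , (1≤j , j≤) , eq with ⊔-sel (v (suc (suc n))) (maxTo v (suc n))
...   | inj₁ p = suc (suc n) , (s≤s z≤n , ≤-refl) , sym p
...   | inj₂ p = j , (1≤j , m≤n⇒m≤1+n j≤) , trans eq (sym p)

maxTo-cong : ∀ {u v} n → (∀ j → j ∈₁ n → u j ≡ v j) → maxTo u n ≡ maxTo v n
maxTo-cong {u} {v} n h = ≤-antisym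
  (maxTo-least u n λ j j∈ → ≤-trans (≤-reflexive (h j j∈)) (maxTo-upper v n j∈))
  (maxTo-least v n λ j j∈ → ≤-trans (≤-reflexive (sym (h j j∈))) (maxTo-upper u n j∈))

-- An occurrence of the consecutive pattern α in the columns a + 1, …, a + length α.
record Occ (w : List (Maybe ℕ)) (α : List ℕ) (a : ℕ) (v : ℕ → ℕ) : Set where
  field
    value : ∀ j → j ∈₁ length α → w ‼ (a + j) ≡ just (v j)
    iso   : ∀ j k → j ∈₁ length α → k ∈₁ length α → (v j < v k) ⇔ (α ! j < α ! k)
open Occ

consecutive-positions : ∀ {i : ℕ → ℕ} l → 1 ≤ i 1 →
  (∀ j → 1 ≤ j → j < l → i (suc j) ≡ suc (i j)) → ∀ j → j ∈₁ l → i j ≡ (i 1 ∸ 1) + j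
consecutive-positions {i} l 1≤i step (suc zero) _ = sym (m∸n+n≡m 1≤i)
consecutive-positions {i} l 1≤i step (suc (suc j)) (_ , j<l) =
  trans (step (suc j) z<s j<l)
    (trans (cong suc (consecutive-positions l 1≤i step (suc j) (z<s , <⇒≤ j<l)))
           (sym (+-suc (i 1 ∸ 1) (suc j))))

∈-dashes⁺ : ∀ {j l} → 1 ≤ j → j < l → j ∈ oneTo (l ∸ 1)
∈-dashes⁺ 1≤j (s≤s j≤) = ∈-oneTo⁺ (1≤j , j≤)

∈-dashes⁻ : ∀ {j l} → j ∈ oneTo (l ∸ 1) → 1 ≤ j × j < l
∈-dashes⁻ {l = zero} ()
∈-dashes⁻ {l = suc l} j∈ with ∈-oneTo⁻ j∈
... | 1≤j , j≤ = 1≤j , s≤s j≤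

Occ⇒Occurrence : ∀ {w α a v} → Occ w α a v → Occurrence w (consecutive α) (a +_) v
Occ⇒Occurrence {a = a} o = record
  { values     = λ j 1≤j j≤ → value o j (1≤j , j≤)
  ; increasing = λ j _ _ → +-monoʳ-< a (n<1+n j)
  ; orderIso   = λ j k 1≤j j≤ 1≤k k≤ → iso o j k (1≤j , j≤) (1≤k , k≤)
  ; adjacent   = λ j _ → +-suc a j }

Occurrence⇒Occ : ∀ {w α i v} → 0 < length α →
  Occurrence w (consecutive α) i v → Occ w α (i 1 ∸ 1) v
Occurrence⇒Occ {w} {α} {i} 0<α o = record
  { value = λ j j∈ → trans (cong (w ‼_) (sym (pos j j∈))) (values j (proj₁ j∈) (proj₂ j∈))
  ; iso   = λ j k (1≤j , j≤) (1≤k , k≤) → orderIso j k 1≤j j≤ 1≤k k≤ }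
  where
  open Occurrence o
  pos : ∀ j → j ∈₁ length α → i j ≡ (i 1 ∸ 1) + j
  pos = consecutive-positions (length α) (proj₁ (‼-bounds w (values 1 ≤-refl 0<α)))
          (λ j 1≤j j<l → adjacent j (∈-dashes⁺ 1≤j j<l))

Occ-transport : ∀ {w w′ α a v} → Occ w α a v →
  (∀ j → j ∈₁ length α → w ‼ (a + j) ≡ w′ ‼ (a + j)) → Occ w′ α a v
Occ-transport o h = record { value = λ j j∈ → trans (sym (h j j∈)) (value o j j∈) ; iso = iso o }

-- A strictly increasing map also reflects `<`, by trichotomy. Monotonicity is asked on the entries
-- of `xs` only, since `s !_` serves as a relabelling just on the positions of `s`.
Occ-monotone : ∀ {xs α a v} (f : ℕ → ℕ) →
  (∀ {x y} → x ∈ xs → y ∈ xs → x < y → f x < f y) →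
  Occ (map just xs) α a v → Occ (map just (map f xs)) α a (f ∘ v)
Occ-monotone {xs} {α} {a} {v} f mono o = record
  { value = λ j j∈ → value′ j j∈
  ; iso   = λ j k j∈ k∈ → mk⇔ (λ lt → to (iso o j k j∈ k∈) (reflect j k j∈ k∈ lt))
                              (λ lt → mono (v∈ j j∈) (v∈ k k∈) (from (iso o j k j∈ k∈) lt)) }
  where
  just∈ : ∀ {x ys} → just x ∈ map just ys → x ∈ ys
  just∈ x∈ with ∈-map⁻ just x∈
  ... | _ , y∈ , refl = y∈
  v∈ : ∀ j → j ∈₁ length α → v j ∈ xs
  v∈ j j∈ = just∈ (‼⇒∈ (map just xs) (value o j j∈))
  pos : ∀ j → j ∈₁ length α → a + j ∈₁ length xs
  pos j j∈ = subst (a + j ∈₁_) (length-map just xs) (‼-bounds (map just xs) (value o j j∈))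
  value′ : ∀ j → j ∈₁ length α → map just (map f xs) ‼ (a + j) ≡ just (f (v j))
  value′ j j∈ = trans (‼-map-just (map f xs) (subst (a + j ∈₁_) (sym (length-map f xs)) p))
    (cong just (trans (!-map f xs p) (cong f (just-injective
      (trans (sym (‼-map-just xs p)) (value o j j∈))))))
    where
    p : a + j ∈₁ length xs
    p = pos j j∈
  reflect : ∀ j k → j ∈₁ length α → k ∈₁ length α → f (v j) < f (v k) → v j < v k
  reflect j k j∈ k∈ lt with <-cmp (v j) (v k)
  ... | tri< p _ _ = p
  ... | tri≈ _ p _ = ⊥-elim (<-irrefl (cong f p) lt)
  ... | tri> _ _ p = ⊥-elim (<-asym lt (mono (v∈ k k∈) (v∈ j j∈) p))

-- Deciding occurrences

val : List (Maybe ℕ) → ℕ → ℕ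
val w c = fromMaybe 0 (w ‼ c)

val-just : ∀ w {c r} → w ‼ c ≡ just r → r ≡ val w c
val-just w eq rewrite eq = refl

Occ? : ∀ w α a v → Dec (Occ w α a v)
Occ? w α a v = map′ (λ (p , q) → record { value = p ; iso = λ j k j∈ k∈ → q j j∈ k k∈ })
                    (λ o → value o , λ j j∈ k k∈ → iso o j k j∈ k∈)
  (all₁? (λ j → Maybe-≟ (w ‼ (a + j)) (just (v j))) (length α)
   ×-dec all₁? (λ j → all₁? (λ k → (v j <? v k) ⇔? ((α ! j) <? (α ! k))) (length α)) (length α))
  where
  Maybe-≟ = ≡-dec _≟_

-- The values of an occurrence are determined by its offset, so that only the offset has to be searched for.
∃Occ? : ∀ w α → 0 < length α → {Q : ℕ → (ℕ → ℕ) → Set} → (∀ a v → Dec (Q a v)) →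
  (∀ {a u v} → (∀ j → j ∈₁ length α → u j ≡ v j) → Q a u → Q a v) →
  Dec (Σ ℕ λ a → Σ (ℕ → ℕ) λ v → Occ w α a v × Q a v)
∃Occ? w α 0<α {Q} Q? resp = map′ (λ (a , _ , o , q) → a , canonical a , o , q) canonicalise
  (anyUpTo? (λ a → Occ? w α a (canonical a) ×-dec Q? a (canonical a)) (length w))
  where
  -- Where `w` has no number, `val` returns 0, but then the field `value` fails, so the default
  -- creates no false occurrence.
  canonical : ℕ → ℕ → ℕ
  canonical a j = val w (a + j)
  canonicalise : (Σ ℕ λ a → Σ (ℕ → ℕ) λ v → Occ w α a v × Q a v) →
    ∃ λ a → a < length w × Occ w α a (canonical a) × Q a (canonical a)
  canonicalise (a , v , o , q) = a , a< , o′ , resp same q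
    where
    same : ∀ j → j ∈₁ length α → v j ≡ canonical a j
    same j j∈ = val-just w (value o j j∈)
    a< : a < length w
    a< = ≤-trans (≤-reflexive (+-comm 1 a)) (proj₂ (‼-bounds w (value o 1 (≤-refl , 0<α))))
    o′ : Occ w α a (canonical a)
    o′ = record
      { value = λ j j∈ → trans (value o j j∈) (cong just (same j j∈))
      ; iso   = λ j k j∈ k∈ → subst₂ (λ x y → (x < y) ⇔ _) (same j j∈) (same k k∈) (iso o j k j∈ k∈) }

-- Cells of a Young board

InBoard? : ∀ λs c r → Dec (InBoard λs c r)
InBoard? λs c r = (1 ≤? c) ×-dec (c ≤? width λs) ×-dec (1 ≤? r) ×-dec (r ≤? λs ! c)

-- Past the last column `!` returns 0, so the heights keep decreasing there and `d` may be any
-- column from `c` on.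
YoungBoard-antitone : ∀ {λs} → YoungBoard λs → ∀ {c d} → 1 ≤ c → c ≤ d → λs ! d ≤ λs ! c
YoungBoard-antitone {λs} (linked , _) = go λs linked
  where
  go : ∀ λs → Linked (λ a b → b ≤ a) λs → ∀ {c d} → 1 ≤ c → c ≤ d → λs ! d ≤ λs ! c
  go [] _ _ _ = z≤n
  go (x ∷ λs) _ {suc zero} {suc zero} _ _ = ≤-refl
  go (x ∷ []) _ {suc zero} {suc (suc d)} _ _ = z≤n
  go (x ∷ y ∷ λs) (y≤x ∷ l) {suc zero} {suc (suc d)} _ _ = ≤-trans (go (y ∷ λs) l {1} {suc d} ≤-refl z<s) y≤x
  go (x ∷ λs) _ {suc (suc c)} {suc zero} _ (s≤s ())
  go (x ∷ []) _ {suc (suc c)} {suc (suc d)} _ _ = z≤n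
  go (x ∷ y ∷ λs) (_ ∷ l) {suc (suc c)} {suc (suc d)} _ (s≤s c≤d) = go (y ∷ λs) l z<s c≤d

InBoard-down : ∀ {λs} → YoungBoard λs → ∀ {c c′ r r′} → 1 ≤ c → c ≤ c′ → 1 ≤ r → r ≤ r′ →
  InBoard λs c′ r′ → InBoard λs c r
InBoard-down young 1≤c c≤c′ 1≤r r≤r′ (_ , c′≤ , _ , r′≤) =
  1≤c , ≤-trans c≤c′ c′≤ , 1≤r , ≤-trans r≤r′ (≤-trans r′≤ (YoungBoard-antitone young 1≤c c≤c′))

-- Covered cells

module Cover (λs : List ℕ) (σ : List ℕ) (0<σ : 0 < length σ) where

  -- An occurrence with offset `a` starts in column `a + 1`, so `c ≤ a` places it strictly to the
  -- right of column `c`. The last condition puts its upper right corner on the board.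
  CoveredBy : ℕ → ℕ → ℕ → (ℕ → ℕ) → Set
  CoveredBy c r a v = c ≤ a × (∀ j → j ∈₁ length σ → r < v j) × InBoard λs (a + length σ) (maxTo v (length σ))

  Covered : List (Maybe ℕ) → ℕ → ℕ → Set
  Covered w c r = Σ ℕ λ a → Σ (ℕ → ℕ) λ v → Occ w σ a v × CoveredBy c r a v

  Covered? : ∀ w c r → Dec (Covered w c r)
  Covered? w c r = ∃Occ? w σ 0<σ
    (λ a v → (c ≤? a) ×-dec all₁? (λ j → r <? v j) (length σ) ×-dec InBoard? λs (a + length σ) (maxTo v (length σ)))
    (λ same (p , q , b) → p , (λ j j∈ → subst (r <_) (same j j∈) (q j j∈)) ,
                          subst (InBoard λs _) (maxTo-cong (length σ) same) b)

  Covered-down : ∀ {w c c′ r r′} → c ≤ c′ → r ≤ r′ → Covered w c′ r′ → Covered w c r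
  Covered-down c≤ r≤ (a , v , o , p , q , b) = a , v , o , ≤-trans c≤ p , (λ j j∈ → ≤-<-trans r≤ (q j j∈)) , b

  -- The cell is to the left of and below the upper right corner of the covering occurrence, which
  -- is on the board.
  Covered-inBoard : YoungBoard λs → ∀ {w c r} → 1 ≤ c → 1 ≤ r → Covered w c r → InBoard λs c r
  Covered-inBoard young 1≤c 1≤r (a , v , o , p , q , b) =
    InBoard-down young 1≤c (≤-trans p (m≤m+n a _)) 1≤r
      (≤-trans (<⇒≤ (q 1 (≤-refl , 0<σ))) (maxTo-upper v (length σ) (≤-refl , 0<σ))) b

  -- If the covering occurrence starts at column c + 1, its first entry is itself covered and lies above r.
  Covered-step : ∀ {w c r r′} → w ‼ suc c ≡ just r′ → Covered w (suc c) r′ → Covered w c r → Covered w (suc c) r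
  Covered-step {w} {c} {r} {r′} eq cov (a , v , o , c≤a , q , b) with m≤n⇒m<n∨m≡n c≤a
  ... | inj₁ c<a = a , v , o , c<a , q , b
  ... | inj₂ refl = Covered-down ≤-refl (<⇒≤ r<r′) cov
    where
    r<r′ : r < r′
    r<r′ = subst (r <_) (just-injective (trans (sym (value o 1 (≤-refl , 0<σ)))
             (trans (cong (w ‼_) (+-comm c 1)) eq))) (q 1 (≤-refl , 0<σ))

  -- For `i ≤ j` the cell is to the left of a covered entry in its own row. For `j ≤ i` start at the
  -- entry in column `a + j` and move right along its row, one column at a time, by `Covered-step`.
  Covered-corner : ∀ {w k a} {v : ℕ → ℕ} → (∀ j → j ∈₁ k → w ‼ (a + j) ≡ just (v j) × Covered w (a + j) (v j)) →
    ∀ i j → i ∈₁ k → j ∈₁ k → Covered w (a + i) (v j)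
  Covered-corner {w} {k} {a} {v} h i j i∈ j∈ with ≤-total i j
  ... | inj₁ i≤j = Covered-down (+-monoʳ-≤ a i≤j) ≤-refl (proj₂ (h j j∈))
  ... | inj₂ j≤i = subst (λ x → Covered w (a + x) (v j)) (m∸n+n≡m j≤i) (go (i ∸ j) (≤-trans (≤-reflexive (m∸n+n≡m j≤i)) (proj₂ i∈)))
    where
    go : ∀ d → d + j ≤ k → Covered w (a + (d + j)) (v j)
    go zero _ = proj₂ (h j j∈)
    go (suc d) d≤ with h (suc (d + j)) (z<s , d≤)
    ... | eq , cov rewrite +-suc a (d + j) = Covered-step eq cov (go d (<⇒≤ d≤))

  module _ {w w′ : List (Maybe ℕ)} {Moved : ℕ → Set} (side : ∀ c → Moved c ⊎ w ‼ c ≡ w′ ‼ c) where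

    -- An occurrence of σ in `w′` that meets no moved column is also one in `w`. Otherwise it has an
    -- entry in a moved column; that cell is covered in `w`, hence so is every cell to its left and
    -- below.
    Covered-reflect : (∀ c r → Moved c → w′ ‼ c ≡ just r → Covered w c r) →
      ∀ {c r} → Covered w′ c r → Covered w c r
    Covered-reflect covered {c} {r} (a , v , o , p , q , b) with choose₁ (side ∘ (a +_)) (length σ)
    ... | inj₁ (j , j∈ , m) = Covered-down (≤-trans p (m≤m+n a j)) (<⇒≤ (q j j∈)) (covered _ _ m (value o j j∈))
    ... | inj₂ fixed = a , v , Occ-transport o (λ j j∈ → sym (fixed j j∈)) , p , q , b

    -- An occurrence meeting a moved column can be replaced by one further to the right.
    Covered-preserve : (∀ c r → Moved c → w ‼ c ≡ just r → Covered w c r) →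
      ∀ {c r} → Covered w c r → Covered w′ c r
    Covered-preserve covered {c} {r} (a , v , o , p , q , b) = go (length w) a v o p q b (m≤n+m _ a)
      where
      -- The offset grows with every replacement, and no occurrence has an offset of `length w` or
      -- more, so `fuel` bounds the number of replacements still possible.
      go : ∀ fuel a v → Occ w σ a v → c ≤ a → (∀ j → j ∈₁ length σ → r < v j) →
        InBoard λs (a + length σ) (maxTo v (length σ)) → length w ≤ a + fuel → Covered w′ c r
      go zero a v o _ _ _ le = ⊥-elim (<⇒≱ (≤-<-trans (≤-reflexive (+-identityʳ a)) (m<m+n a z<s))
        (≤-trans (proj₂ (‼-bounds w (value o 1 (≤-refl , 0<σ)))) le))
      go (suc fuel) a v o p q b le with choose₁ (side ∘ (a +_)) (length σ)
      ... | inj₂ fixed = a , v , Occ-transport o fixed , p , q , b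
      ... | inj₁ (j , j∈ , m) with covered _ _ m (value o j j∈)
      ...   | a′ , v′ , o′ , p′ , q′ , b′ = go fuel a′ v′ o′ (≤-trans p (≤-trans (m≤m+n a j) p′))
              (λ i i∈ → <-trans (q j j∈) (q′ i i∈)) b′
              (≤-trans le (≤-trans (≤-reflexive (+-suc a fuel)) (+-monoˡ-≤ fuel
                (≤-trans (≤-trans (≤-reflexive (+-comm 1 a)) (+-monoʳ-≤ a (proj₁ j∈))) p′))))

-- Occurrences of a direct sum

-- The shift is written `j + k` to agree with the `map (_+ k)` in the direct sum.
data Split (k l : ℕ) : ℕ → Set where
  left  : ∀ {j} → j ∈₁ k → Split k l j
  right : ∀ {j} → j ∈₁ l → Split k l (j + k)

split : ∀ k {l j} → j ∈₁ k + l → Split k l j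
split k {l} {j} (1≤j , j≤) with j ≤? k
... | yes j≤k = left (1≤j , j≤k)
... | no j≰k = subst (Split k l) (m∸n+n≡m (<⇒≤ (≰⇒> j≰k)))
  (right (m<n⇒0<n∸m (≰⇒> j≰k) , ≤-trans (∸-monoˡ-≤ k j≤) (≤-reflexive (m+n∸m≡n k l))))

join : ℕ → (ℕ → ℕ) → (ℕ → ℕ) → ℕ → ℕ
join k f g j with j ≤? k
... | yes _ = f j
... | no _ = g (j ∸ k)

join-left : ∀ k f g {j} → j ≤ k → join k f g j ≡ f j
join-left k f g {j} j≤k with j ≤? k
... | yes _ = refl
... | no j≰k = ⊥-elim (j≰k j≤k)

join-right : ∀ k f g {j} → 1 ≤ j → join k f g (j + k) ≡ g j
join-right k f g {j} 1≤j with j + k ≤? k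
... | yes le = ⊥-elim (<⇒≱ (m<n+m k 1≤j) le)
... | no _ = cong g (m+n∸n≡m j k)

module DirectSum (α σ : List ℕ) (permα : IsPerm (length α) α) (0<α : 0 < length α)
  (permσ : IsPerm (length σ) σ) (0<σ : 0 < length σ) (λs : List ℕ) where

  open Cover λs σ 0<σ

  private
    k = length α
    l = length σ
    ρ = α ++ map (_+ k) σ

  length-ρ : length ρ ≡ k + l
  length-ρ = trans (length-++ α) (cong (k +_) (length-map (_+ k) σ))

  ρ-left : ∀ {j} → j ∈₁ k → ρ ! j ≡ α ! j
  ρ-left = !-++ˡ α

  ρ-right : ∀ {j} → j ∈₁ l → ρ ! (j + k) ≡ (σ ! j) + k
  ρ-right j∈ = trans (!-++ʳ α (proj₁ j∈)) (!-map (_+ k) σ j∈)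

  α<σ : ∀ {i j} → i ∈₁ k → j ∈₁ l → α ! i < (σ ! j) + k
  α<σ i∈ j∈ = ≤-<-trans (proj₂ (IsPerm-bounds permα (!-∈ α i∈)))
                        (m<n+m k (proj₁ (IsPerm-bounds permσ (!-∈ σ j∈))))

  ρ-left<right : ∀ {i j} → i ∈₁ k → j ∈₁ l → ρ ! i < ρ ! (j + k)
  ρ-left<right i∈ j∈ = subst₂ _<_ (sym (ρ-left i∈)) (sym (ρ-right j∈)) (α<σ i∈ j∈)

  -- Only the α-part remains to be located: the σ-part is hidden in the covering of the upper right
  -- corner of the α-part.
  Contains : List (Maybe ℕ) → Set
  Contains w = Σ ℕ λ a → Σ (ℕ → ℕ) λ v → Occ w α a v × Covered w (a + k) (maxTo v k)

  Contains? : ∀ w → Dec (Contains w)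
  Contains? w = ∃Occ? w α 0<α (λ a v → Covered? w (a + k) (maxTo v k))
    (λ {a} same → subst (Covered w (a + k)) (maxTo-cong k same))

  FillContains⇒Contains : ∀ {w} → FillContains λs w (consecutive α ⊕ consecutive σ) → Contains w
  FillContains⇒Contains {w} (i , v , o , b) =
    i 1 ∸ 1 , v ,
    record { value = λ j j∈ → trans (cong (w ‼_) (sym (posα j j∈))) (values j (proj₁ j∈) (inα j∈))
           ; iso = λ x y x∈ y∈ → subst₂ (λ p q → (v x < v y) ⇔ (p < q)) (ρ-left x∈) (ρ-left y∈)
                                   (orderIso x y (proj₁ x∈) (inα x∈) (proj₁ y∈) (inα y∈)) } ,
    i (1 + k) ∸ 1 , v ∘ (_+ k) ,
    record { value = λ j j∈ → trans (cong (w ‼_) (sym (posσ j j∈))) (values (j + k) (pos j∈) (inσ j∈))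
           ; iso = λ x y x∈ y∈ → mk⇔
               (λ lt → +-cancelʳ-< k (σ ! x) (σ ! y) (subst₂ _<_ (ρ-right x∈) (ρ-right y∈)
                         (to (orderIso (x + k) (y + k) (pos x∈) (inσ x∈) (pos y∈) (inσ y∈)) lt)))
               (λ lt → from (orderIso (x + k) (y + k) (pos x∈) (inσ x∈) (pos y∈) (inσ y∈))
                         (subst₂ _<_ (sym (ρ-right x∈)) (sym (ρ-right y∈)) (+-monoˡ-< k lt))) } ,
    subst (_≤ i (1 + k) ∸ 1) (posα k (0<α , ≤-refl))
      (∸-monoˡ-≤ 1 (increasing k 0<α (≤-trans (m<m+n k 0<σ) (≤-reflexive (sym length-ρ))))) ,
    above ,
    corner b
    where
    open Occurrence o
    inα : ∀ {j} → j ∈₁ k → j ≤ length ρ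
    inα (_ , j≤k) = ≤-trans (≤-trans j≤k (m≤m+n k l)) (≤-reflexive (sym length-ρ))
    inσ : ∀ {j} → j ∈₁ l → j + k ≤ length ρ
    inσ {j} (_ , j≤l) = ≤-trans (≤-trans (+-monoˡ-≤ k j≤l) (≤-reflexive (+-comm l k))) (≤-reflexive (sym length-ρ))
    pos : ∀ {j} → j ∈₁ l → 1 ≤ j + k
    pos {j} (1≤j , _) = ≤-trans 1≤j (m≤m+n j k)
    1∈l : 1 ∈₁ l
    1∈l = ≤-refl , 0<σ
    -- No adjacency condition links position `k` to position `k + 1`, so the two parts have
    -- independent offsets, determined by `i 1` and `i (1 + k)`.
    posα : ∀ j → j ∈₁ k → i j ≡ (i 1 ∸ 1) + j
    posα = consecutive-positions k (proj₁ (‼-bounds w (values 1 ≤-refl (inα (≤-refl , 0<α)))))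
      (λ j 1≤j j< → adjacent j (∈-++⁺ˡ (∈-dashes⁺ 1≤j j<)))
    posσ : ∀ j → j ∈₁ l → i (j + k) ≡ (i (1 + k) ∸ 1) + j
    posσ = consecutive-positions {i ∘ (_+ k)} l (proj₁ (‼-bounds w (values (1 + k) (pos 1∈l) (inσ 1∈l))))
      (λ j 1≤j j< → adjacent (j + k) (∈-++⁺ʳ (oneTo (k ∸ 1)) (∈-map⁺ (_+ k) (∈-dashes⁺ 1≤j j<))))
    above : ∀ j → j ∈₁ l → maxTo v k < v (j + k)
    above j j∈ with maxTo-attained v k 0<α
    ... | j₀ , j₀∈ , eq = subst (_< v (j + k)) eq
      (from (orderIso j₀ (j + k) (proj₁ j₀∈) (inα j₀∈) (pos j∈) (inσ j∈)) (ρ-left<right j₀∈ j∈))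
    corner : InBoard λs (i (length ρ)) (maxTo v (length ρ)) →
      InBoard λs ((i (1 + k) ∸ 1) + l) (maxTo (v ∘ (_+ k)) l)
    corner b with subst (λ c → InBoard λs c (maxTo v (length ρ)))
                    (trans (cong i (trans length-ρ (+-comm k l))) (posσ l (0<σ , ≤-refl))) b
    ... | 1≤c , c≤ , _ , r≤ = 1≤c , c≤ ,
      ≤-trans (≤-<-trans z≤n (above 1 1∈l)) (maxTo-upper (v ∘ (_+ k)) l 1∈l) ,
      ≤-trans (maxTo-least (v ∘ (_+ k)) l (λ j j∈ → maxTo-upper v (length ρ) (pos j∈ , inσ j∈))) r≤

  Contains⇒FillContains : ∀ {w} → Contains w → FillContains λs w (consecutive α ⊕ consecutive σ)
  Contains⇒FillContains {w} (a , v , o , a′ , v′ , o′ , c≤ , above , b) =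
    i , u , record
      { values = λ j 1≤j j≤ → vals (view 1≤j j≤)
      ; increasing = λ j 1≤j j< → incr j 1≤j j<
      ; orderIso = λ x y 1≤x x≤ 1≤y y≤ → isos (view 1≤x x≤) (view 1≤y y≤)
      ; adjacent = adj } ,
    subst₂ (InBoard λs) (sym i-last) (sym u-max) b
    where
    i u : ℕ → ℕ
    i = join k (a +_) (a′ +_)
    u = join k v v′
    view : ∀ {j} → 1 ≤ j → j ≤ length ρ → Split k l j
    view {j} 1≤j j≤ = split k (1≤j , subst (j ≤_) length-ρ j≤)
    iˡ : ∀ {j} → j ≤ k → i j ≡ a + j
    iˡ = join-left k (a +_) (a′ +_)
    iʳ : ∀ {j} → 1 ≤ j → i (j + k) ≡ a′ + j
    iʳ = join-right k (a +_) (a′ +_)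
    uˡ : ∀ {j} → j ∈₁ k → u j ≡ v j
    uˡ (_ , j≤k) = join-left k v v′ j≤k
    uʳ : ∀ {j} → j ∈₁ l → u (j + k) ≡ v′ j
    uʳ (1≤j , _) = join-right k v v′ 1≤j
    vals : ∀ {j} → Split k l j → w ‼ i j ≡ just (u j)
    vals (left j∈) = trans (cong (w ‼_) (iˡ (proj₂ j∈))) (trans (value o _ j∈) (cong just (sym (uˡ j∈))))
    vals (right j∈) = trans (cong (w ‼_) (iʳ (proj₁ j∈))) (trans (value o′ _ j∈) (cong just (sym (uʳ j∈))))
    incr : ∀ j → 1 ≤ j → j < length ρ → i j < i (suc j)
    incr j 1≤j j< with view 1≤j (<⇒≤ j<)
    ... | right {j′} j∈ = subst₂ _<_ (sym (iʳ (proj₁ j∈))) (sym (iʳ {suc j′} z<s)) (+-monoʳ-< a′ (n<1+n j′))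
    ... | left (_ , j≤k) with m≤n⇒m<n∨m≡n j≤k
    ...   | inj₁ j<k = subst₂ _<_ (sym (iˡ j≤k)) (sym (iˡ j<k)) (+-monoʳ-< a (n<1+n j))
    -- The seam between the two parts: column `a + k` precedes column `a′ + 1` because the covering
    -- occurrence satisfies `a + k ≤ a′`.
    ...   | inj₂ refl = subst₂ _<_ (sym (iˡ ≤-refl)) (sym (iʳ {1} ≤-refl)) (≤-<-trans c≤ (m<m+n a′ z<s))
    left<right : ∀ {x y} → x ∈₁ k → y ∈₁ l → u x < u (y + k)
    left<right x∈ y∈ = subst₂ _<_ (sym (uˡ x∈)) (sym (uʳ y∈)) (≤-<-trans (maxTo-upper v k x∈) (above _ y∈))
    isos : ∀ {x y} → Split k l x → Split k l y → (u x < u y) ⇔ (ρ ! x < ρ ! y)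
    isos (left x∈) (left y∈) = subst₂ _⇔_ (sym (cong₂ _<_ (uˡ x∈) (uˡ y∈)))
      (sym (cong₂ _<_ (ρ-left x∈) (ρ-left y∈))) (iso o _ _ x∈ y∈)
    isos (left x∈) (right y∈) = mk⇔ (λ _ → ρ-left<right x∈ y∈) (λ _ → left<right x∈ y∈)
    isos (right x∈) (left y∈) = mk⇔ (λ lt → ⊥-elim (<-asym lt (left<right y∈ x∈)))
                                    (λ lt → ⊥-elim (<-asym lt (ρ-left<right y∈ x∈)))
    isos (right x∈) (right y∈) = subst₂ _⇔_ (sym (cong₂ _<_ (uʳ x∈) (uʳ y∈)))
      (sym (cong₂ _<_ (ρ-right x∈) (ρ-right y∈)))
      (mk⇔ (λ lt → +-monoˡ-< k (to (iso o′ _ _ x∈ y∈) lt))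
           (λ lt → from (iso o′ _ _ x∈ y∈) (+-cancelʳ-< k _ _ lt)))
    adj : ∀ j → j ∈ oneTo (k ∸ 1) ++ map (_+ k) (oneTo (l ∸ 1)) → i (suc j) ≡ suc (i j)
    adj j j∈ with ∈-++⁻ (oneTo (k ∸ 1)) j∈
    ... | inj₁ j∈α = trans (iˡ (proj₂ (∈-dashes⁻ {j} {k} j∈α)))
      (trans (+-suc a j) (cong suc (sym (iˡ (<⇒≤ (proj₂ (∈-dashes⁻ {j} {k} j∈α)))))))
    ... | inj₂ j∈σ with ∈-map⁻ (_+ k) j∈σ
    ...   | j′ , j′∈ , refl = trans (iʳ {suc j′} z<s)
      (trans (+-suc a′ j′) (cong suc (sym (iʳ (proj₁ (∈-dashes⁻ {j′} {l} j′∈))))))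
    i-last : i (length ρ) ≡ a′ + l
    i-last = trans (cong i (trans length-ρ (+-comm k l))) (iʳ 0<σ)
    -- The σ-part lies above the whole α-part, so the full occurrence has the same upper right
    -- corner as its σ-part.
    u-max : maxTo u (length ρ) ≡ maxTo v′ l
    u-max = ≤-antisym
      (maxTo-least u (length ρ) (λ j (1≤j , j≤) → below (view 1≤j j≤)))
      (maxTo-least v′ l (λ j j∈ → subst (_≤ maxTo u (length ρ)) (uʳ j∈)
        (maxTo-upper u (length ρ) (≤-trans (proj₁ j∈) (m≤m+n j k) ,
          ≤-trans (+-monoˡ-≤ k (proj₂ j∈)) (≤-reflexive (trans (+-comm l k) (sym length-ρ)))))))
      where
      below : ∀ {j} → Split k l j → u j ≤ maxTo v′ l
      below (left j∈) = ≤-trans (<⇒≤ (left<right j∈ (≤-refl , 0<σ)))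
        (≤-trans (≤-reflexive (uʳ (≤-refl , 0<σ))) (maxTo-upper v′ l (≤-refl , 0<σ)))
      below (right j∈) = ≤-trans (≤-reflexive (uʳ j∈)) (maxTo-upper v′ l j∈)

-- Cutting a word into runs

infixr 5 _∣_∣_

-- The separators will be the empty columns and the uncovered entries. Runs may be empty, so
-- neighbouring separators need no case of their own.
data Blocks : Set where
  run   : List ℕ → Blocks
  _∣_∣_ : List ℕ → Maybe ℕ → Blocks → Blocks

flatten : Blocks → List (Maybe ℕ)
flatten (run xs) = map just xs
flatten (xs ∣ x ∣ B) = map just xs ++ x ∷ flatten B

mapRuns : (List ℕ → List ℕ) → Blocks → Blocks
mapRuns f (run xs) = run (f xs)
mapRuns f (xs ∣ x ∣ B) = f xs ∣ x ∣ mapRuns f B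

-- RunAt B a xs: the run xs occupies the columns a + 1, …, a + length xs.
data RunAt : Blocks → ℕ → List ℕ → Set where
  last  : ∀ {xs} → RunAt (run xs) 0 xs
  first : ∀ {xs x B} → RunAt (xs ∣ x ∣ B) 0 xs
  later : ∀ {xs x B a ys} → RunAt B a ys → RunAt (xs ∣ x ∣ B) (length xs + suc a) ys

data SepAt : Blocks → ℕ → Maybe ℕ → Set where
  first : ∀ {xs x B} → SepAt (xs ∣ x ∣ B) (length xs + 1) x
  later : ∀ {xs x B c y} → SepAt B c y → SepAt (xs ∣ x ∣ B) (length xs + suc c) y

InRun : Blocks → ℕ → Set
InRun B c = Σ ℕ λ a → Σ (List ℕ) λ xs → Σ ℕ λ j → RunAt B a xs × j ∈₁ length xs × c ≡ a + j

‼-prefix : ∀ xs w {j} → j ∈₁ length xs → (map just xs ++ w) ‼ j ≡ just (xs ! j)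
‼-prefix xs w {j} j∈ = trans (‼-++ˡ (map just xs) (subst (j ∈₁_) (sym (length-map just xs)) j∈)) (‼-map-just xs j∈)

‼-suffix : ∀ xs x w {c} → 1 ≤ c → (map just xs ++ x ∷ w) ‼ (length xs + suc c) ≡ w ‼ c
‼-suffix xs x w {suc c} _ = trans (cong (λ n → (map just xs ++ x ∷ w) ‼ (n + suc (suc c))) (sym (length-map just xs)))
  (‼-++ʳ (map just xs) z<s)

RunAt-‼ : ∀ {B a xs j} → RunAt B a xs → j ∈₁ length xs → flatten B ‼ (a + j) ≡ just (xs ! j)
RunAt-‼ {j = j} (last {xs}) j∈ = ‼-map-just xs j∈
RunAt-‼ (first {xs} {x} {B}) j∈ = ‼-prefix xs (x ∷ flatten B) j∈
RunAt-‼ {j = j} (later {xs} {x} {B} {a} r) j∈ =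
  trans (cong (flatten (xs ∣ x ∣ B) ‼_) (+-assoc (length xs) (suc a) j))
    (trans (‼-suffix xs x (flatten B) (≤-trans (proj₁ j∈) (m≤n+m j a))) (RunAt-‼ r j∈))

SepAt-pos : ∀ {B c x} → SepAt B c x → 1 ≤ c
SepAt-pos (first {xs}) = m≤n+m 1 (length xs)
SepAt-pos (later {xs} s) = ≤-trans (s≤s z≤n) (m≤n+m _ (length xs))

SepAt-‼ : ∀ {B c x} → SepAt B c x → flatten B ‼ c ≡ x
SepAt-‼ (first {xs} {x} {B}) = trans (cong (λ n → flatten (xs ∣ x ∣ B) ‼ (n + 1)) (sym (length-map just xs)))
  (‼-++ʳ (map just xs) ≤-refl)
SepAt-‼ (later {xs} {x} {B} s) = trans (‼-suffix xs x (flatten B) (SepAt-pos s)) (SepAt-‼ s)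

InRun-later : ∀ {xs x B c} → InRun B c → InRun (xs ∣ x ∣ B) (length xs + suc c)
InRun-later {xs} (a , ys , j , r , j∈ , refl) =
  length xs + suc a , ys , j , later r , j∈ , sym (+-assoc (length xs) (suc a) j)

data Column (xs : List ℕ) : ℕ → Set where
  inside : ∀ {j} → j ∈₁ length xs → Column xs j
  sep    : Column xs (length xs + 1)
  after  : ∀ {c} → 1 ≤ c → Column xs (length xs + suc c)

column : ∀ xs c → 1 ≤ c → Column xs c
column xs c 1≤c with c ≤? length xs
... | yes c≤ = inside (1≤c , c≤)
... | no c≰ with c ∸ length xs | m+[n∸m]≡n (<⇒≤ (≰⇒> c≰)) | m<n⇒0<n∸m (≰⇒> c≰)
...   | suc zero    | refl | _ = sep
...   | suc (suc d) | refl | _ = after z<s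

cover : ∀ B c → c ∈₁ length (flatten B) → InRun B c ⊎ ∃ (SepAt B c)
cover (run xs) c (1≤c , c≤) = inj₁ (0 , xs , c , last , (1≤c , subst (c ≤_) (length-map just xs) c≤) , refl)
cover (xs ∣ x ∣ B) c (1≤c , c≤) with column xs c 1≤c
... | inside j∈ = inj₁ (0 , xs , _ , first , j∈ , refl)
... | sep = inj₂ (x , first)
... | after {c′} 1≤c′ with cover B c′ (1≤c′ , s≤s⁻¹ (+-cancelˡ-≤ (length xs) _ _
        (≤-trans c≤ (≤-reflexive (trans (length-++ (map just xs)) (cong (_+ suc (length (flatten B))) (length-map just xs)))))))
...   | inj₁ r = inj₁ (InRun-later r)
...   | inj₂ (y , s) = inj₂ (y , later s)

-- A window without separators cannot leave its run. If it does not fit into the first run, either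
-- it starts no later than the separator after that run and so contains it, or it lies entirely
-- beyond and the search continues in the rest.
window : ∀ B a k → 0 < k → a + k ≤ length (flatten B) → (∀ j → j ∈₁ k → ∀ x → ¬ SepAt B (a + j) x) →
  Σ ℕ λ b → Σ ℕ λ d → Σ (List ℕ) λ xs → RunAt B b xs × a ≡ b + d × d + k ≤ length xs
window (run xs) a k 0<k le _ = 0 , a , xs , last , refl , subst (a + k ≤_) (length-map just xs) le
window (xs ∣ x ∣ B) a k 0<k le noSep with a + k ≤? length xs
... | yes a+k≤ = 0 , a , xs , first , refl , a+k≤
... | no a+k≰ with a ≤? length xs
...   | yes a≤ = ⊥-elim (noSep (suc (length xs ∸ a)) (z<s , sep≤) x
          (subst (λ c → SepAt (xs ∣ x ∣ B) c x) pos first))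
  where
  pos : length xs + 1 ≡ a + suc (length xs ∸ a)
  pos = trans (+-comm (length xs) 1) (trans (cong suc (sym (m+[n∸m]≡n a≤))) (sym (+-suc a _)))
  sep≤ : suc (length xs ∸ a) ≤ k
  sep≤ = +-cancelˡ-≤ a _ _ (≤-trans (≤-reflexive (trans (sym pos) (+-comm (length xs) 1))) (≰⇒> a+k≰))
...   | no a≰ with window B (a ∸ suc (length xs)) k 0<k le′ noSep′
  where
  a≡ : a ≡ length xs + suc (a ∸ suc (length xs))
  a≡ = trans (sym (m+[n∸m]≡n (≰⇒> a≰))) (sym (+-suc (length xs) _))
  le′ : (a ∸ suc (length xs)) + k ≤ length (flatten B)
  le′ = +-cancelˡ-≤ (suc (length xs)) _ _ (≤-trans (≤-reflexive
    (trans (sym (+-assoc (suc (length xs)) (a ∸ suc (length xs)) k)) (cong (_+ k) (m+[n∸m]≡n (≰⇒> a≰)))))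
    (≤-trans le (≤-reflexive (trans (length-++ (map just xs))
      (trans (cong (_+ suc (length (flatten B))) (length-map just xs)) (+-suc (length xs) _))))))
  noSep′ : ∀ j → j ∈₁ k → ∀ y → ¬ SepAt B ((a ∸ suc (length xs)) + j) y
  noSep′ j j∈ y s = noSep j j∈ y (subst (λ c → SepAt (xs ∣ x ∣ B) c y)
    (trans (sym (+-assoc (length xs) _ j)) (cong (_+ j) (sym a≡))) (later s))
...     | b , d , ys , r , eq , d+k≤ = length xs + suc b , d , ys , later r ,
          trans (sym (m+[n∸m]≡n (≰⇒> a≰))) (trans (sym (+-suc (length xs) _))
            (trans (cong (λ c → length xs + suc c) eq) (sym (+-assoc (length xs) (suc b) d)))) , d+k≤

-- The constructor `later` has the length of the first run in its index. A run and its rearrangement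
-- have equal lengths only up to a proof, hence the variable `n`.
RunAt-later : ∀ {xs x B a ys n} → length xs ≡ n → RunAt B a ys → RunAt (xs ∣ x ∣ B) (n + suc a) ys
RunAt-later refl = later

SepAt-first : ∀ {xs x B n} → length xs ≡ n → SepAt (xs ∣ x ∣ B) (n + 1) x
SepAt-first refl = first

SepAt-later : ∀ {xs x B c y n} → length xs ≡ n → SepAt B c y → SepAt (xs ∣ x ∣ B) (n + suc c) y
SepAt-later refl = later

module _ {f : List ℕ → List ℕ} where

  RunAt-map⁺ : ∀ {B a xs} → (∀ {a xs} → RunAt B a xs → f xs ↭ xs) → RunAt B a xs → RunAt (mapRuns f B) a (f xs)
  RunAt-map⁺ h last = last
  RunAt-map⁺ h first = first
  RunAt-map⁺ h (later r) = RunAt-later (↭-length (h first)) (RunAt-map⁺ (h ∘ later) r)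

  RunAt-map⁻ : ∀ {B a ys} → (∀ {a xs} → RunAt B a xs → f xs ↭ xs) → RunAt (mapRuns f B) a ys →
    ∃ λ xs → RunAt B a xs × ys ≡ f xs
  RunAt-map⁻ {run xs} h last = xs , last , refl
  RunAt-map⁻ {xs ∣ x ∣ B} h first = xs , first , refl
  RunAt-map⁻ {xs ∣ x ∣ B} h (later r) with RunAt-map⁻ (h ∘ later) r
  ... | zs , r′ , eq = zs , RunAt-later (sym (↭-length (h first))) r′ , eq

  SepAt-map⁺ : ∀ {B c x} → (∀ {a xs} → RunAt B a xs → f xs ↭ xs) → SepAt B c x → SepAt (mapRuns f B) c x
  SepAt-map⁺ h first = SepAt-first (↭-length (h first))
  SepAt-map⁺ h (later s) = SepAt-later (↭-length (h first)) (SepAt-map⁺ (h ∘ later) s)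

  SepAt-map⁻ : ∀ {B c x} → (∀ {a xs} → RunAt B a xs → f xs ↭ xs) → SepAt (mapRuns f B) c x → SepAt B c x
  SepAt-map⁻ {xs ∣ x ∣ B} h first = SepAt-first (sym (↭-length (h first)))
  SepAt-map⁻ {xs ∣ x ∣ B} h (later s) = SepAt-later (sym (↭-length (h first))) (SepAt-map⁻ (h ∘ later) s)

  flatten-map-↭ : ∀ {B} → (∀ {a xs} → RunAt B a xs → f xs ↭ xs) → flatten (mapRuns f B) ↭ flatten B
  flatten-map-↭ {run xs} h = map⁺ just (h last)
  flatten-map-↭ {xs ∣ x ∣ B} h = ++⁺ (map⁺ just (h first)) (prep x (flatten-map-↭ (h ∘ later)))

  mapRuns-inverse : ∀ {g : List ℕ → List ℕ} {B} → (∀ {a xs} → RunAt B a xs → g (f xs) ≡ xs) →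
    mapRuns g (mapRuns f B) ≡ B
  mapRuns-inverse {B = run xs} h = cong run (h last)
  mapRuns-inverse {B = xs ∣ x ∣ B} h = cong₂ (_∣ x ∣_) (h first) (mapRuns-inverse (h ∘ later))

-- Maximal runs of a decidable predicate

cons : ℕ → Blocks → Blocks
cons y (run xs) = run (y ∷ xs)
cons y (xs ∣ x ∣ B) = (y ∷ xs) ∣ x ∣ B

flatten-cons : ∀ y B → flatten (cons y B) ≡ just y ∷ flatten B
flatten-cons y (run xs) = refl
flatten-cons y (xs ∣ x ∣ B) = refl

-- Every suffix is numbered from column 1 again; shifting the predicate by `suc` replaces a column
-- counter.
blocks : {P : ℕ → ℕ → Set} → (∀ c r → Dec (P c r)) → List (Maybe ℕ) → Blocks
blocks P? [] = run []
blocks P? (nothing ∷ w) = [] ∣ nothing ∣ blocks (P? ∘ suc) w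
blocks P? (just r ∷ w) with P? 1 r
... | yes _ = cons r (blocks (P? ∘ suc) w)
... | no _ = [] ∣ just r ∣ blocks (P? ∘ suc) w

flatten-blocks : {P : ℕ → ℕ → Set} (P? : ∀ c r → Dec (P c r)) → ∀ w → flatten (blocks P? w) ≡ w
flatten-blocks P? [] = refl
flatten-blocks P? (nothing ∷ w) = cong (nothing ∷_) (flatten-blocks (P? ∘ suc) w)
flatten-blocks P? (just r ∷ w) with P? 1 r
... | yes _ = trans (flatten-cons r (blocks (P? ∘ suc) w)) (cong (just r ∷_) (flatten-blocks (P? ∘ suc) w))
... | no _ = cong (just r ∷_) (flatten-blocks (P? ∘ suc) w)

-- Since entries used as separators fail `P`, the runs are maximal, and a word has at most one valid
-- cutting.
record Valid (P : ℕ → ℕ → Set) (B : Blocks) : Set where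
  field
    runs : ∀ {a xs j} → RunAt B a xs → j ∈₁ length xs → P (a + j) (xs ! j)
    seps : ∀ {c r} → SepAt B c (just r) → ¬ P c r
open Valid public

data RunAtCons (y : ℕ) (B : Blocks) : ℕ → List ℕ → Set where
  extended : ∀ {xs} → RunAt B 0 xs → RunAtCons y B 0 (y ∷ xs)
  shifted  : ∀ {a xs} → RunAt B a xs → RunAtCons y B (suc a) xs

RunAt-cons⁻ : ∀ {y B a xs} → RunAt (cons y B) a xs → RunAtCons y B a xs
RunAt-cons⁻ {B = run xs} last = extended last
RunAt-cons⁻ {B = xs ∣ x ∣ B} first = extended first
RunAt-cons⁻ {B = xs ∣ x ∣ B} (later r) = shifted (later r)

RunAt-cons⁺ : ∀ {y B a xs} → RunAt B a xs → (a ≡ 0 × RunAt (cons y B) 0 (y ∷ xs)) ⊎ RunAt (cons y B) (suc a) xs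
RunAt-cons⁺ last = inj₁ (refl , last)
RunAt-cons⁺ first = inj₁ (refl , first)
RunAt-cons⁺ (later r) = inj₂ (later r)

SepAt-cons⁺ : ∀ {y B c x} → SepAt B c x → SepAt (cons y B) (suc c) x
SepAt-cons⁺ first = first
SepAt-cons⁺ (later s) = later s

SepAt-cons⁻ : ∀ {y B c x} → SepAt (cons y B) c x → ∃ λ d → c ≡ suc d × SepAt B d x
SepAt-cons⁻ {B = xs ∣ x ∣ B} first = _ , refl , first
SepAt-cons⁻ {B = xs ∣ x ∣ B} (later s) = _ , refl , later s

Valid-cons⁺ : ∀ {P y B} → P 1 y → Valid (P ∘ suc) B → Valid P (cons y B)
Valid-cons⁺ {P} {y} {B} p v = record
  { runs = λ r → go (RunAt-cons⁻ r)
  ; seps = λ s → case-sep (SepAt-cons⁻ s) }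
  where
  go : ∀ {a xs j} → RunAtCons y B a xs → j ∈₁ length xs → P (a + j) (xs ! j)
  go {j = suc zero} (extended r) j∈ = p
  go {j = suc (suc j)} (extended r) (_ , s≤s j≤) = runs v r (z<s , j≤)
  go (shifted r) j∈ = runs v r j∈
  case-sep : ∀ {c r} → (∃ λ d → c ≡ suc d × SepAt B d (just r)) → ¬ P c r
  case-sep (d , refl , s) = seps v s

Valid-cons⁻ : ∀ {P y B} → Valid P (cons y B) → P 1 y × Valid (P ∘ suc) B
Valid-cons⁻ {P} {y} {B} v = head B v , record { runs = tail ; seps = λ s → seps v (SepAt-cons⁺ s) }
  where
  head : ∀ B → Valid P (cons y B) → P 1 y
  head (run xs) v = runs v {j = 1} last (≤-refl , z<s)
  head (xs ∣ x ∣ B) v = runs v {j = 1} first (≤-refl , z<s)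
  tail : ∀ {a xs j} → RunAt B a xs → j ∈₁ length xs → P (suc (a + j)) (xs ! j)
  tail {j = suc j} r j∈ with RunAt-cons⁺ {y} r
  ... | inj₁ (refl , r′) = runs v r′ (z<s , s≤s (proj₂ j∈))
  ... | inj₂ r′ = runs v r′ j∈

Valid-sep⁺ : ∀ {P x B} → (∀ {r} → x ≡ just r → ¬ P 1 r) → Valid (P ∘ suc) B → Valid P ([] ∣ x ∣ B)
Valid-sep⁺ {P} {x} {B} ¬p v = record { runs = go ; seps = go′ }
  where
  go : ∀ {a xs j} → RunAt ([] ∣ x ∣ B) a xs → j ∈₁ length xs → P (a + j) (xs ! j)
  go first (s≤s _ , ())
  go (later r) j∈ = runs v r j∈
  go′ : ∀ {c r} → SepAt ([] ∣ x ∣ B) c (just r) → ¬ P c r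
  go′ first = ¬p refl
  go′ (later s) = seps v s

Valid-sep⁻ : ∀ {P x B} → Valid P ([] ∣ x ∣ B) → (∀ {r} → x ≡ just r → ¬ P 1 r) × Valid (P ∘ suc) B
Valid-sep⁻ v = (λ { refl → seps v first }) , record { runs = λ r → runs v (later r) ; seps = λ s → seps v (later s) }

Valid-blocks : {P : ℕ → ℕ → Set} (P? : ∀ c r → Dec (P c r)) → ∀ w → Valid P (blocks P? w)
Valid-blocks P? [] = record { runs = λ { last (s≤s _ , ()) } ; seps = λ () }
Valid-blocks P? (nothing ∷ w) = Valid-sep⁺ (λ ()) (Valid-blocks (P? ∘ suc) w)
Valid-blocks P? (just r ∷ w) with P? 1 r
... | yes p = Valid-cons⁺ p (Valid-blocks (P? ∘ suc) w)
... | no ¬p = Valid-sep⁺ (λ { refl → ¬p }) (Valid-blocks (P? ∘ suc) w)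

blocks-cons : {P : ℕ → ℕ → Set} (P? : ∀ c r → Dec (P c r)) → ∀ y w → P 1 y →
  blocks P? (just y ∷ w) ≡ cons y (blocks (P? ∘ suc) w)
blocks-cons P? y w p with P? 1 y
... | yes _ = refl
... | no ¬p = ⊥-elim (¬p p)

blocks-sep : {P : ℕ → ℕ → Set} (P? : ∀ c r → Dec (P c r)) → ∀ x w → (∀ {r} → x ≡ just r → ¬ P 1 r) →
  blocks P? (x ∷ w) ≡ [] ∣ x ∣ blocks (P? ∘ suc) w
blocks-sep P? nothing w ¬p = refl
blocks-sep P? (just r) w ¬p with P? 1 r
... | yes p = ⊥-elim (¬p refl p)
... | no _ = refl

-- Validity tells for the first letter whether `P` holds, so `blocks` makes the same choice, and
-- what remains is valid for the shifted predicate. This recovers the runs from an exchanged word,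
-- which is what makes the exchange invertible.
blocks-flatten : {P : ℕ → ℕ → Set} (P? : ∀ c r → Dec (P c r)) → ∀ B → Valid P B → blocks P? (flatten B) ≡ B
blocks-flatten P? (run []) v = refl
blocks-flatten P? (run (y ∷ ys)) v = trans (blocks-cons P? y _ (proj₁ (Valid-cons⁻ {B = run ys} v)))
  (cong (cons y) (blocks-flatten (P? ∘ suc) (run ys) (proj₂ (Valid-cons⁻ {B = run ys} v))))
blocks-flatten P? ([] ∣ x ∣ B) v = trans (blocks-sep P? x _ (proj₁ (Valid-sep⁻ v)))
  (cong ([] ∣ x ∣_) (blocks-flatten (P? ∘ suc) B (proj₂ (Valid-sep⁻ v))))
blocks-flatten P? ((y ∷ ys) ∣ x ∣ B) v = trans (blocks-cons P? y _ (proj₁ (Valid-cons⁻ {B = ys ∣ x ∣ B} v)))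
  (cong (cons y) (blocks-flatten (P? ∘ suc) (ys ∣ x ∣ B) (proj₂ (Valid-cons⁻ {B = ys ∣ x ∣ B} v))))

-- Exchanging the avoiders of two Wilf-equivalent patterns

module _ {A : Set} (_≟A_ : DecidableEquality A) where

  -- A bijection read off from two duplicate-free enumerations of equal length; the value `x`
  -- elsewhere only makes it total.
  match : List A → List A → A → A
  match (y ∷ ys) (z ∷ zs) x with x ≟A y
  ... | yes _ = z
  ... | no _ = match ys zs x
  match _ _ x = x

  match-∈ : ∀ ys zs {x} → length ys ≡ length zs → x ∈ ys → match ys zs x ∈ zs
  match-∈ (y ∷ ys) (z ∷ zs) {x} eq x∈ with x ≟A y | x∈
  ... | yes _ | _ = here refl
  ... | no x≢y | here x≡y = ⊥-elim (x≢y x≡y)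
  ... | no _ | there x∈′ = there (match-∈ ys zs (suc-injective eq) x∈′)

  match-inverse : ∀ ys zs {x} → length ys ≡ length zs → Unique zs → x ∈ ys → match zs ys (match ys zs x) ≡ x
  match-inverse (y ∷ ys) (z ∷ zs) {x} eq uniq x∈ with x ≟A y | x∈
  match-inverse (y ∷ ys) (z ∷ zs) {x} eq uniq x∈ | yes x≡y | _ with z ≟A z
  ... | yes _ = sym x≡y
  ... | no z≢z = ⊥-elim (z≢z refl)
  match-inverse (y ∷ ys) (z ∷ zs) {x} eq uniq x∈ | no x≢y | here x≡y = ⊥-elim (x≢y x≡y)
  match-inverse (y ∷ ys) (z ∷ zs) {x} eq uniq@(_ ∷ uniq′) x∈ | no _ | there x∈′ with match ys zs x ≟A z
  -- If the image of `x` were `z`, the way back would stop at `y`. But the image is in `zs`, which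
  -- does not contain `z`.
  ... | yes m≡z = ⊥-elim (Unique[x∷xs]⇒x∉xs uniq (subst (_∈ zs) m≡z (match-∈ ys zs (suc-injective eq) x∈′)))
  ... | no _ = match-inverse ys zs (suc-injective eq) uniq′ x∈′

-- The comparison counts `y` itself, so ranks start at 1, and on a strictly increasing list `rank s`
-- inverts the 1-indexed access `s !_`.
rank : List ℕ → ℕ → ℕ
rank [] y = 0
rank (x ∷ s) y with x ≤? y
... | yes _ = suc (rank s y)
... | no _ = rank s y

map-!-oneTo : ∀ s → map (s !_) (oneTo (length s)) ≡ s
map-!-oneTo [] = refl
map-!-oneTo (x ∷ s) = cong (x ∷_) (trans (sym (map-∘ _)) (trans
  (cong (map (λ k → (x ∷ s) ! suc k)) (sym (map-upTo suc (length s))))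
  (trans (map-cong-local (All.tabulate λ k∈ → shift (proj₁ (∈-oneTo⁻ k∈)))) (map-!-oneTo s))))
  where
  shift : ∀ {k} → 1 ≤ k → (x ∷ s) ! suc k ≡ s ! k
  shift {suc k} _ = refl

rank-below : ∀ {s y} → All (y <_) s → rank s y ≡ 0
rank-below [] = refl
rank-below {x ∷ s} {y} (y<x ∷ y<s) with x ≤? y
... | yes x≤y = ⊥-elim (<⇒≱ y<x x≤y)
... | no _ = rank-below y<s

rank-! : ∀ {s} → AllPairs _<_ s → ∀ {k} → k ∈₁ length s → rank s (s ! k) ≡ k
rank-! {x ∷ s} (x<s ∷ sorted) {suc zero} _ with x ≤? x
... | yes _ = cong suc (rank-below x<s)
... | no x≰x = ⊥-elim (x≰x ≤-refl)
rank-! {x ∷ s} (x<s ∷ sorted) {suc (suc k)} (_ , s≤s k≤) with x ≤? (s ! suc k)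
... | yes _ = cong suc (rank-! sorted (z<s , k≤))
... | no x≰ = ⊥-elim (x≰ (<⇒≤ (All.lookup x<s (!-∈ s (z<s , k≤)))))

!-mono-< : ∀ {s} → AllPairs _<_ s → ∀ {i j} → i ∈₁ length s → j ∈₁ length s → i < j → s ! i < s ! j
!-mono-< {[]} _ (s≤s _ , ())
!-mono-< {x ∷ s} (x<s ∷ _) {suc zero} {suc (suc j)} _ (_ , s≤s j≤) _ = All.lookup x<s (!-∈ s (z<s , j≤))
!-mono-< {x ∷ s} (_ ∷ sorted) {suc (suc i)} {suc (suc j)} (_ , s≤s i≤) (_ , s≤s j≤) (s≤s i<j) =
  !-mono-< sorted (z<s , i≤) (z<s , j≤) i<j
!-mono-< {x ∷ s} _ {suc zero} {suc zero} _ _ (s≤s ())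
!-mono-< {x ∷ s} _ {suc (suc i)} {suc zero} _ _ (s≤s ())

!-rank : ∀ {s} → AllPairs _<_ s → ∀ {y} → y ∈ s → s ! rank s y ≡ y
!-rank {s} sorted y∈ with ∈-! y∈
... | k , k∈ , refl = cong (s !_) (rank-! sorted k∈)

rank-mono-< : ∀ {s} → AllPairs _<_ s → ∀ {x y} → x ∈ s → y ∈ s → x < y → rank s x < rank s y
rank-mono-< {s} sorted x∈ y∈ x<y with ∈-! x∈ | ∈-! y∈
... | i , i∈ , refl | j , j∈ , refl = subst₂ _<_ (sym (rank-! sorted i∈)) (sym (rank-! sorted j∈)) i<j
  where
  i<j : i < j
  i<j with <-cmp i j
  ... | tri< p _ _ = p
  ... | tri≈ _ refl _ = ⊥-elim (<-irrefl refl x<y)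
  ... | tri> _ _ p = ⊥-elim (<-asym x<y (!-mono-< sorted j∈ i∈ p))

map-rank : ∀ {s} → AllPairs _<_ s → map (rank s) s ≡ oneTo (length s)
map-rank {s} sorted = trans (cong (map (rank s)) (sym (map-!-oneTo s)))
  (trans (sym (map-∘ _)) (map-id-local (All.tabulate (rank-! sorted ∘ ∈-oneTo⁻))))

Unique-resp-↭ : ∀ {A : Set} {xs ys : List A} → xs ↭ ys → Unique xs → Unique ys
Unique-resp-↭ {A} p = Permₛ.Unique-resp-↭ (setoid A) (↭⇒↭ₛ p)

sort-strict : ∀ {xs} → Unique xs → AllPairs _<_ (sort xs)
sort-strict {xs} uniq = AllPairs.zipWith (λ (x≤y , x≢y) → ≤∧≢⇒< x≤y x≢y)
  (Linked⇒AllPairs ≤-trans (sort-↗ xs) , Unique-resp-↭ (↭-sym (sort-↭ xs)) uniq)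

-- A sorted list is determined by its entries. Hence a run and its rearrangement are relabelled
-- through the same list, as undoing the exchange demands.
sort-cong : ∀ {xs ys} → xs ↭ ys → sort xs ≡ sort ys
sort-cong {xs} {ys} p = Pointwise-≡⇒≡ (↗↭↗⇒≋ ≤-totalOrder (sort-↗ xs) (sort-↗ ys)
  (↭⇒↭ₛ (↭-trans (sort-↭ xs) (↭-trans p (↭-sym (sort-↭ ys))))))

∃Occ : List ℕ → List ℕ → Set
∃Occ xs α = Σ ℕ λ a → Σ (ℕ → ℕ) λ v → Occ (map just xs) α a v

WilfEquivalent-sym : ∀ {p q} → WilfEquivalent p q → WilfEquivalent q p
WilfEquivalent-sym W n = proj₁ (W n) , proj₂ (proj₂ (W n)) , proj₁ (proj₂ (W n))

module _ {p q : VPattern} (W : WilfEquivalent p q) where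

  avoidersˡ avoidersʳ : ℕ → List (List ℕ)
  avoidersˡ n = proj₁ (proj₁ (proj₂ (W n)))
  avoidersʳ n = proj₁ (proj₂ (proj₂ (W n)))

  wilfMap : ℕ → List ℕ → List ℕ
  wilfMap n = match (List.≡-dec _≟_) (avoidersˡ n) (avoidersʳ n)

  -- wilfMap conjugated by the order isomorphism between the entries of s and 1, …, n.
  relabelled : List ℕ → ℕ → List ℕ → List ℕ
  relabelled s n xs = map (s !_) (wilfMap n (map (rank s) xs))

  exchange : List ℕ → List ℕ
  exchange xs = relabelled (sort xs) (length xs) xs

  length-avoiders : ∀ n → length (avoidersˡ n) ≡ length (avoidersʳ n)
  length-avoiders n with W n
  ... | m , (_ , _ , _ , eq) , (_ , _ , _ , eq′) = trans eq (sym eq′)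

  ∈-avoidersˡ : ∀ n π → (π ∈ avoidersˡ n) ⇔ (IsPerm n π × ¬ PermContains π p)
  ∈-avoidersˡ n = proj₁ (proj₂ (proj₂ (proj₁ (proj₂ (W n)))))

  ∈-avoidersʳ : ∀ n π → (π ∈ avoidersʳ n) ⇔ (IsPerm n π × ¬ PermContains π q)
  ∈-avoidersʳ n = proj₁ (proj₂ (proj₂ (proj₂ (proj₂ (W n)))))

  Unique-avoidersʳ : ∀ n → Unique (avoidersʳ n)
  Unique-avoidersʳ n = proj₁ (proj₂ (proj₂ (proj₂ (W n))))

module Exchange {α β : List ℕ} (0<α : 0 < length α) (0<β : 0 < length β)
  (W : WilfEquivalent (consecutive α) (consecutive β)) {xs : List ℕ} (uniq : Unique xs) (avoid : ¬ ∃Occ xs α) where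

  private
    s = sort xs
    n = length xs
    -- The standardisation of the run, followed by its partner among the permutations avoiding β.
    π = map (rank s) xs
    ρ = wilfMap W n π

    sorted : AllPairs _<_ s
    sorted = sort-strict uniq

    length-s : length s ≡ n
    length-s = ↭-length (sort-↭ xs)

    ∈s : ∀ {x} → x ∈ xs → x ∈ s
    ∈s = ∈-resp-↭ (↭-sym (sort-↭ xs))

    map-!-π : map (s !_) π ≡ xs
    map-!-π = trans (sym (map-∘ xs)) (map-id-local (All.tabulate (!-rank sorted ∘ ∈s)))

    π-perm : IsPerm n π
    π-perm = ↭-trans (map⁺ (rank s) (↭-sym (sort-↭ xs)))
      (↭-reflexive (trans (map-rank sorted) (cong oneTo length-s)))

    perm-bounds : ∀ {τ} → IsPerm n τ → ∀ {k} → k ∈ τ → k ∈₁ length s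
    perm-bounds perm k∈ = subst (_ ∈₁_) (sym length-s) (IsPerm-bounds perm k∈)

    !-mono : ∀ {τ} → IsPerm n τ → ∀ {i j} → i ∈ τ → j ∈ τ → i < j → s ! i < s ! j
    !-mono perm i∈ j∈ = !-mono-< sorted (perm-bounds perm i∈) (perm-bounds perm j∈)

    π∈ : π ∈ avoidersˡ W n
    π∈ = from (∈-avoidersˡ W n π) (π-perm , λ (i , v , o) → avoid
      (_ , (s !_) ∘ v , subst (λ ys → Occ (map just ys) α _ ((s !_) ∘ v)) map-!-π
        (Occ-monotone (s !_) (!-mono π-perm) (Occurrence⇒Occ 0<α o))))

    ρ-avoider : IsPerm n ρ × ¬ PermContains ρ (consecutive β)
    ρ-avoider = to (∈-avoidersʳ W n ρ) (match-∈ _ _ _ (length-avoiders W n) π∈)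

    ρ-perm : IsPerm n ρ
    ρ-perm = proj₁ ρ-avoider

    map-rank-! : map (rank s) (exchange W xs) ≡ ρ
    map-rank-! = trans (sym (map-∘ ρ)) (map-id-local (All.tabulate (rank-! sorted ∘ perm-bounds ρ-perm)))

  exchange-↭ : exchange W xs ↭ xs
  exchange-↭ = ↭-trans (map⁺ (s !_) ρ-perm) (↭-trans
    (↭-reflexive (trans (cong (map (s !_) ∘ oneTo) (sym length-s)) (map-!-oneTo s))) (sort-↭ xs))

  exchange-avoids : ¬ ∃Occ (exchange W xs) β
  exchange-avoids (a , v , o) = proj₂ ρ-avoider (_ , _ , Occ⇒Occurrence
    (subst (λ ys → Occ (map just ys) β a (rank s ∘ v)) map-rank-!
      (Occ-monotone (rank s) (λ x∈ y∈ → rank-mono-< sorted (∈s′ x∈) (∈s′ y∈)) o)))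
    where
    ∈s′ : ∀ {x} → x ∈ exchange W xs → x ∈ s
    ∈s′ = ∈s ∘ ∈-resp-↭ exchange-↭

  exchange-inverse : exchange (WilfEquivalent-sym W) (exchange W xs) ≡ xs
  exchange-inverse = trans
    -- The backward exchange computes its own sorted list and length; being a rearrangement of `xs`,
    -- the exchanged run yields `s` and `n` again.
    (cong₂ (λ t m → relabelled (WilfEquivalent-sym W) t m (exchange W xs)) (sort-cong exchange-↭) (↭-length exchange-↭))
    (trans (cong (map (s !_)) (trans (cong (wilfMap (WilfEquivalent-sym W) n) map-rank-!)
      (match-inverse _ _ _ (length-avoiders W n) (Unique-avoidersʳ W n) π∈))) map-!-π)

-- Finite sets

enumerate : {A : Set} {P : A → Set} → DecidableEquality A → (∀ x → Dec (P x)) →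
  (U : List A) → (∀ x → P x → x ∈ U) → ∃ (HasCard P)
enumerate _≟A_ P? U complete = _ , filter P? (deduplicate _≟A_ U) ,
  Unique-filter⁺ P? (deduplicate-! _≟A_ U) ,
  (λ x → mk⇔ (λ x∈ → proj₂ (∈-filter⁻ P? {xs = deduplicate _≟A_ U} x∈)) (λ px → ∈-filter⁺ P? (∈-deduplicate⁺ _≟A_ (complete x px)) px)) ,
  refl

HasCard-bijection : {A : Set} {P Q : A → Set} (f g : A → A) →
  (∀ x → P x → Q (f x) × g (f x) ≡ x) → (∀ y → Q y → P (g y) × f (g y) ≡ y) →
  ∀ {m} → HasCard P m → HasCard Q m
HasCard-bijection {A} {P} {Q} f g hf hg (L , uniq , ∈L , len) =
  map f L , unique L (λ x∈ → to (∈L _) x∈) uniq ,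
  (λ y → mk⇔ (fwd y) (λ qy → subst (_∈ map f L) (proj₂ (hg y qy)) (∈-map⁺ f (from (∈L (g y)) (proj₁ (hg y qy)))))) ,
  trans (length-map f L) len
  where
  fwd : ∀ y → y ∈ map f L → Q y
  fwd y y∈ with ∈-map⁻ f y∈
  ... | x , x∈ , refl = proj₁ (hf x (to (∈L x) x∈))
  unique : ∀ L → (∀ {x} → x ∈ L → P x) → Unique L → Unique (map f L)
  unique [] _ _ = []
  unique (x ∷ L) p (x∉ ∷ u) = All.tabulate distinct ∷ unique L (p ∘ there) u
    where
    distinct : ∀ {y} → y ∈ map f L → f x ≢ y
    distinct y∈ eq with ∈-map⁻ f y∈
    ... | z , z∈ , refl = All.lookup x∉ z∈ (trans (sym (proj₂ (hf x (p (here refl)))))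
      (trans (cong g eq) (proj₂ (hf z (p (there z∈))))))

-- Fillings

Word-≟ : DecidableEquality (List (Maybe ℕ))
Word-≟ = List.≡-dec (≡-dec _≟_)

letters : ℕ → List (Maybe ℕ)
letters h = nothing ∷ map just (oneTo h)

-- A finite universe that contains all fillings of a board with width `n` and height `h`; the
-- fillings are then filtered out of it.
words : ℕ → ℕ → List (List (Maybe ℕ))
words zero h = [] ∷ []
words (suc n) h = cartesianProductWith _∷_ (letters h) (words n h)

∈-words : ∀ {h w} → All (_∈ letters h) w → w ∈ words (length w) h
∈-words [] = here refl
∈-words (x∈ ∷ w∈) = ∈-cartesianProductWith⁺ _∷_ x∈ (∈-words w∈)

module _ {λs : List ℕ} (young : YoungBoard λs) where

  !≤height : ∀ {c} → 1 ≤ c → λs ! c ≤ height λs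
  !≤height {c} 1≤c = ≤-trans (YoungBoard-antitone young {1} {c} ≤-refl 1≤c) (!1≤height λs)
    where
    !1≤height : ∀ λs → λs ! 1 ≤ height λs
    !1≤height [] = z≤n
    !1≤height (_ ∷ _) = ≤-refl

  filling∈words : ∀ {C R w} → FillingCR λs C R w → w ∈ words (width λs) (height λs)
  filling∈words {w = w} fill = subst (λ n → w ∈ words n (height λs)) (len fill) (∈-words (All.tabulate letter∈))
    where
    letter∈ : ∀ {x} → x ∈ w → x ∈ letters (height λs)
    letter∈ {nothing} _ = here refl
    letter∈ {just r} r∈ with ∈⇒‼ r∈
    ... | c , eq with inBoard fill c r eq
    ...   | 1≤c , _ , 1≤r , r≤ = there (∈-map⁺ just (∈-oneTo⁺ (1≤r , ≤-trans r≤ (!≤height 1≤c))))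

∀just? : {P : ℕ → Set} → (∀ r → Dec (P r)) → ∀ x → Dec (∀ r → x ≡ just r → P r)
∀just? P? nothing = yes λ _ ()
∀just? P? (just r) = map′ (λ { p _ refl → p }) (λ h → h r refl) (P? r)

-- All quantifiers reduce to finite ranges: only columns of the word hold numbers, the row of a
-- column is read off its letter, and a row is occupied iff `just r` is a letter.
FillingCR? : ∀ λs C R w → Dec (FillingCR λs C R w)
FillingCR? λs C R w = map′
  (λ (l , b , u , c , r) → record
    { len = l
    ; inBoard = λ c r eq → b c (‼-bounds w eq) r eq
    ; rowUnique = λ c c′ r eq eq′ → u c (‼-bounds w eq) r eq c′ (‼-bounds w eq′) eq′
    ; emptyCols = λ j 1≤j j≤ → c j (1≤j , j≤)
    ; emptyRows = λ j 1≤j j≤ → r j (1≤j , j≤) })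
  (λ fill → len fill , (λ c _ r eq → inBoard fill c r eq) ,
    (λ c _ r eq c′ _ eq′ → rowUnique fill c c′ r eq eq′) ,
    (λ j (1≤j , j≤) → emptyCols fill j 1≤j j≤) , (λ j (1≤j , j≤) → emptyRows fill j 1≤j j≤))
  ((length w ≟ width λs)
   ×-dec all₁? (λ c → ∀just? (InBoard? λs c) (w ‼ c)) (length w)
   ×-dec all₁? (λ c → ∀just? (λ r → all₁? (λ c′ → ((w ‼ c′) ≟ᴹ just r) →-dec (c ≟ c′)) (length w)) (w ‼ c)) (length w)
   ×-dec all₁? (λ c → ((w ‼ c) ≟ᴹ nothing) ⇔? (c ∈? C)) (width λs)
   ×-dec all₁? (λ r → ¬? (map′ ∈⇒‼ (λ (c , eq) → ‼⇒∈ w eq) (just r ∈ᴹ? w)) ⇔? (r ∈? R)) (height λs))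
  where
  _≟ᴹ_ = ≡-dec _≟_
  open DecMembership _≟_ using (_∈?_)
  open DecMembership _≟ᴹ_ using () renaming (_∈?_ to _∈ᴹ?_)

-- Rearranging the letters of a filling

‼-outside : ∀ w {c} → ¬ c ∈₁ length w → w ‼ c ≡ nothing
‼-outside w {c} c∉ with w ‼ c in eq
... | nothing = refl
... | just r = ⊥-elim (c∉ (‼-bounds w eq))

-- Row uniqueness as a symmetric relation between letters, which passes to rearranged words.
-- Distinctness of letters would be too strong, as empty columns may repeat.
Compatible : Maybe ℕ → Maybe ℕ → Set
Compatible x y = ∀ r → x ≡ just r → y ≢ just r

RowUnique : List (Maybe ℕ) → Set
RowUnique w = ∀ c c′ r → w ‼ c ≡ just r → w ‼ c′ ≡ just r → c ≡ c′

RowUnique⇒Compatible : ∀ w → RowUnique w → AllPairs Compatible w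
RowUnique⇒Compatible [] _ = []
RowUnique⇒Compatible (x ∷ w) uniq = All.tabulate compatible ∷ RowUnique⇒Compatible w rest
  where
  compatible : ∀ {y} → y ∈ w → Compatible x y
  compatible y∈ r refl refl with ∈⇒‼ y∈
  ... | zero , eq = n≮0 (proj₁ (‼-bounds w eq))
  ... | suc c , eq with uniq 1 (suc (suc c)) r refl eq
  ...   | ()
  rest : RowUnique w
  rest zero c′ r eq eq′ = ⊥-elim (n≮0 (proj₁ (‼-bounds w eq)))
  rest (suc c) zero r eq eq′ = ⊥-elim (n≮0 (proj₁ (‼-bounds w eq′)))
  rest (suc c) (suc c′) r eq eq′ = suc-injective (uniq (suc (suc c)) (suc (suc c′)) r eq eq′)

Compatible⇒RowUnique : ∀ w → AllPairs Compatible w → RowUnique w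
Compatible⇒RowUnique (x ∷ w) (x# ∷ w#) (suc zero) (suc zero) r _ _ = refl
Compatible⇒RowUnique (x ∷ w) (x# ∷ w#) (suc zero) (suc (suc c′)) r eq eq′ =
  ⊥-elim (All.lookup x# (‼⇒∈ w eq′) r eq refl)
Compatible⇒RowUnique (x ∷ w) (x# ∷ w#) (suc (suc c)) (suc zero) r eq eq′ =
  ⊥-elim (All.lookup x# (‼⇒∈ w eq) r eq′ refl)
Compatible⇒RowUnique (x ∷ w) (x# ∷ w#) (suc (suc c)) (suc (suc c′)) r eq eq′ =
  cong suc (Compatible⇒RowUnique w w# (suc c) (suc c′) r eq eq′)

-- A rearrangement keeps the width, the row uniqueness and the set of occupied rows. The conditions
-- that depend on positions, the board and the empty columns, are left as hypotheses.
FillingCR-↭ : ∀ {λs C R w w′} → FillingCR λs C R w → w′ ↭ w →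
  (∀ c r → w′ ‼ c ≡ just r → InBoard λs c r) → (∀ c → (w′ ‼ c ≡ nothing) ⇔ (w ‼ c ≡ nothing)) →
  FillingCR λs C R w′
FillingCR-↭ {w = w} {w′} fill p board empty = record
  { len = trans (↭-length p) (len fill)
  ; inBoard = board
  ; rowUnique = Compatible⇒RowUnique w′ (Permₛ.AllPairs-resp-↭ (setoid (Maybe ℕ)) (λ x#y r eq eq′ → x#y r eq′ eq)
      ((λ { refl c → c }) , (λ { refl c → c })) (↭⇒↭ₛ (↭-sym p)) (RowUnique⇒Compatible w (rowUnique fill)))
  ; emptyCols = λ c 1≤c c≤ → let e = emptyCols fill c 1≤c c≤ in
      mk⇔ (to e ∘ to (empty c)) (from (empty c) ∘ from e)
  ; emptyRows = λ r 1≤r r≤ → let e = emptyRows fill r 1≤r r≤ in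
      mk⇔ (λ none → to e (none ∘ move w w′ (↭-sym p))) (λ r∈ → from e r∈ ∘ move w′ w p) }
  where
  move : ∀ u u′ → u ↭ u′ → ∀ {r} → (∃ λ c → u ‼ c ≡ just r) → ∃ λ c → u′ ‼ c ≡ just r
  move u u′ p (c , eq) = ∈⇒‼ (∈-resp-↭ p (‼⇒∈ u eq))

!-injective⇒Unique : ∀ xs → (∀ i j → i ∈₁ length xs → j ∈₁ length xs → xs ! i ≡ xs ! j → i ≡ j) → Unique xs
!-injective⇒Unique [] _ = []
!-injective⇒Unique (x ∷ xs) inj = All.tabulate compatible ∷ !-injective⇒Unique xs rest
  where
  compatible : ∀ {y} → y ∈ xs → x ≢ y
  compatible y∈ refl with ∈-! y∈
  ... | suc j , (_ , j≤) , eq with inj 1 (suc (suc j)) (≤-refl , z<s) (z<s , s≤s j≤) (sym eq)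
  ...   | ()
  rest : ∀ i j → i ∈₁ length xs → j ∈₁ length xs → xs ! i ≡ xs ! j → i ≡ j
  rest (suc i) (suc j) (_ , i≤) (_ , j≤) eq =
    suc-injective (inj (suc (suc i)) (suc (suc j)) (z<s , s≤s i≤) (z<s , s≤s j≤) eq)

RunAt-Unique : ∀ {B a xs} → RowUnique (flatten B) → RunAt B a xs → Unique xs
RunAt-Unique {B} {a} {xs} uniq r = !-injective⇒Unique xs λ i j i∈ j∈ eq →
  +-cancelˡ-≡ a i j (uniq (a + i) (a + j) (xs ! i) (RunAt-‼ r i∈) (trans (RunAt-‼ r j∈) (cong just (sym eq))))

Occ-fromRun : ∀ {B a xs α b v} → RunAt B a xs → Occ (map just xs) α b v → Occ (flatten B) α (a + b) v
Occ-fromRun {B} {a} {xs} {α} {b} {v} r o = record { value = val′ ; iso = Occ.iso o }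
  where
  val′ : ∀ j → j ∈₁ length α → flatten B ‼ (a + b + j) ≡ just (v j)
  val′ j j∈ = trans (cong (flatten B ‼_) (+-assoc a b j))
    (trans (RunAt-‼ r p) (trans (sym (‼-map-just xs p)) (Occ.value o j j∈)))
    where
    p : b + j ∈₁ length xs
    p = subst (b + j ∈₁_) (length-map just xs) (‼-bounds (map just xs) (Occ.value o j j∈))

Occ-toRun : ∀ {B a xs α b v} → RunAt B a xs → b + length α ≤ length xs →
  Occ (flatten B) α (a + b) v → Occ (map just xs) α b v
Occ-toRun {B} {a} {xs} {α} {b} {v} r le o = record { value = val′ ; iso = Occ.iso o }
  where
  val′ : ∀ j → j ∈₁ length α → map just xs ‼ (b + j) ≡ just (v j)
  val′ j (1≤j , j≤) = trans (‼-map-just xs p) (trans (sym (RunAt-‼ r p))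
    (trans (cong (flatten B ‼_) (sym (+-assoc a b j))) (Occ.value o j (1≤j , j≤))))
    where
    p : b + j ∈₁ length xs
    p = ≤-trans 1≤j (m≤n+m j b) , ≤-trans (+-monoʳ-≤ b j≤) le

-- The exchange on all runs of a filling

module Transfer {α β σ : List ℕ} (permα : IsPerm (length α) α) (0<α : 0 < length α)
  (permβ : IsPerm (length β) β) (0<β : 0 < length β) (permσ : IsPerm (length σ) σ) (0<σ : 0 < length σ)
  (W : WilfEquivalent (consecutive α) (consecutive β)) {λs : List ℕ} (young : YoungBoard λs) where

  open Cover λs σ 0<σ
  private
    module α⊕σ = DirectSum α σ permα 0<α permσ 0<σ λs
    module β⊕σ = DirectSum β σ permβ 0<β permσ 0<σ λs

  exchangeRuns : List (Maybe ℕ) → List (Maybe ℕ)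
  exchangeRuns w = flatten (mapRuns (exchange W) (blocks (Covered? w) w))

  module _ {C R} (B : Blocks) (valid : Valid (Covered (flatten B)) B)
    (fill : FillingCR λs C R (flatten B)) (avoid : ¬ α⊕σ.Contains (flatten B)) where

    private
      B′ = mapRuns (exchange W) B
      w  = flatten B
      w′ = flatten B′

    -- Inside a run all entries of an occurrence of α are covered, so by `Covered-corner` its upper
    -- right corner is covered too, and `w` would contain the direct sum.
    run-avoids : ∀ {a xs} → RunAt B a xs → ¬ ∃Occ xs α
    run-avoids {a} {xs} r (b , v , o) with maxTo-attained v (length α) 0<α
    ... | j , j∈ , eq = avoid (a + b , v , o′ , subst (Covered w _) eq
        (Covered-corner (λ i i∈ → Occ.value o′ i i∈ , covered i i∈) (length α) j (0<α , ≤-refl) j∈))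
      where
      o′ : Occ w α (a + b) v
      o′ = Occ-fromRun r o
      covered : ∀ i → i ∈₁ length α → Covered w (a + b + i) (v i)
      covered i i∈ = subst₂ (Covered w) (sym (+-assoc a b i))
        (just-injective (trans (sym (‼-map-just xs p)) (Occ.value o i i∈))) (runs valid r p)
        where
        p : b + i ∈₁ length xs
        p = subst (b + i ∈₁_) (length-map just xs) (‼-bounds (map just xs) (Occ.value o i i∈))

    module Run {a xs} (r : RunAt B a xs) =
      Exchange 0<α 0<β W (RunAt-Unique (rowUnique fill) r) (run-avoids r)

    permutes : ∀ {a xs} → RunAt B a xs → exchange W xs ↭ xs
    permutes r = Run.exchange-↭ r

    w′↭w : w′ ↭ w
    w′↭w = flatten-map-↭ permutes

    -- Runs keep their lengths, so separators keep their columns; outside the word both sides read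
    -- `nothing`.
    side : ∀ c → InRun B c ⊎ w ‼ c ≡ w′ ‼ c
    side c with (1 ≤? c) ×-dec (c ≤? length w)
    ... | no c∉ = inj₂ (trans (‼-outside w c∉)
            (sym (‼-outside w′ (c∉ ∘ subst (c ∈₁_) (↭-length w′↭w)))))
    ... | yes c∈ with cover B c c∈
    ...   | inj₁ r = inj₁ r
    ...   | inj₂ (x , s) = inj₂ (trans (SepAt-‼ s) (sym (SepAt-‼ (SepAt-map⁺ permutes s))))

    RunAt-‼′ : ∀ {a xs j} → RunAt B a xs → j ∈₁ length xs → w′ ‼ (a + j) ≡ just (exchange W xs ! j)
    RunAt-‼′ {j = j} r j∈ = RunAt-‼ (RunAt-map⁺ permutes r) (subst (j ∈₁_) (sym (↭-length (permutes r))) j∈)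

    run-covered : ∀ c r → InRun B c → w ‼ c ≡ just r → Covered w c r
    run-covered _ r (a , xs , j , at , j∈ , refl) eq =
      subst (Covered w (a + j)) (just-injective (trans (sym (RunAt-‼ at j∈)) eq)) (runs valid at j∈)

    -- The new entry comes from some column `i` of the same run, so its row meets column `j` in a
    -- cell of the run, covered by `Covered-corner`.
    run-covered′ : ∀ c r → InRun B c → w′ ‼ c ≡ just r → Covered w c r
    run-covered′ _ r (a , xs , j , at , j∈ , refl) eq
      with ∈-! (∈-resp-↭ (permutes at) (subst (_∈ exchange W xs) (just-injective (trans (sym (RunAt-‼′ at j∈)) eq))
             (!-∈ (exchange W xs) (subst (j ∈₁_) (sym (↭-length (permutes at))) j∈))))
    ... | i , i∈ , refl = Covered-corner (λ k k∈ → RunAt-‼ at k∈ , runs valid at k∈) j i j∈ i∈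

    -- By `Covered-preserve` the new entries of the runs are covered in `w′`, and by
    -- `Covered-reflect` no separator becomes covered. So `B′` is the cutting from which the
    -- exchange is undone.
    valid′ : Valid (Covered w′) B′
    valid′ = record { runs = runs′ ; seps = λ s → seps valid (SepAt-map⁻ permutes s) ∘ Covered-reflect side run-covered′ }
      where
      runs′ : ∀ {a ys j} → RunAt B′ a ys → j ∈₁ length ys → Covered w′ (a + j) (ys ! j)
      runs′ {a} {j = j} at′ j∈ with RunAt-map⁻ permutes at′
      ... | xs , at , refl = Covered-preserve side run-covered
        (run-covered′ (a + j) _ (a , xs , j , at , j∈xs , refl) (RunAt-‼′ at j∈xs))
        where
        j∈xs : j ∈₁ length xs
        j∈xs = subst (j ∈₁_) (↭-length (permutes at)) j∈

    filling′ : FillingCR λs C R w′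
    filling′ = FillingCR-↭ fill w′↭w board empty
      where
      board : ∀ c r → w′ ‼ c ≡ just r → InBoard λs c r
      board c r eq with side c
      ... | inj₂ same = inBoard fill c r (trans same eq)
      -- A moved entry is on the board because its cell is covered; that its row is positive is seen
      -- at its old column `c₀`.
      ... | inj₁ at with ∈⇒‼ (∈-resp-↭ w′↭w (‼⇒∈ w′ eq))
      ...   | c₀ , eq₀ = Covered-inBoard young (proj₁ (‼-bounds w′ eq))
              (proj₁ (proj₂ (proj₂ (inBoard fill c₀ r eq₀)))) (run-covered′ c r at eq)
      empty : ∀ c → (w′ ‼ c ≡ nothing) ⇔ (w ‼ c ≡ nothing)
      empty c with side c
      ... | inj₂ same = mk⇔ (trans same) (trans (sym same))
      ... | inj₁ (a , xs , j , at , j∈ , refl) = mk⇔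
        (λ eq → case-absurd (trans (sym (RunAt-‼′ at j∈)) eq)) (λ eq → case-absurd (trans (sym (RunAt-‼ at j∈)) eq))
        where
        case-absurd : ∀ {r : ℕ} {P : Set} → just r ≡ nothing → P
        case-absurd ()

    -- If the upper right corner of an occurrence of β is covered, so are all its entries. None of
    -- them is then a separator, so `window` puts the occurrence into a single run, which avoids β.
    avoids′ : ¬ β⊕σ.Contains w′
    avoids′ (a , v , o , cov) with window B′ a (length β) 0<β
        (proj₂ (‼-bounds w′ (Occ.value o (length β) (0<β , ≤-refl)))) noSep
      where
      noSep : ∀ j → j ∈₁ length β → ∀ x → ¬ SepAt B′ (a + j) x
      noSep j j∈ x s with trans (sym (SepAt-‼ s)) (Occ.value o j j∈)
      ... | refl = seps valid′ s (Covered-down (+-monoʳ-≤ a (proj₂ j∈)) (maxTo-upper v (length β) j∈) cov)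
    ... | b , d , ys , at′ , refl , le with RunAt-map⁻ permutes at′
    ...   | xs , at , refl = Run.exchange-avoids at (d , v , Occ-toRun at′ le o)

    inverse′ : mapRuns (exchange (WilfEquivalent-sym W)) B′ ≡ B
    inverse′ = mapRuns-inverse λ r → Run.exchange-inverse r

  -- The second component is, with `exchangeRuns` of the reversed equivalence unfolded, the inverse
  -- law that `HasCard-bijection` asks for.
  transfer : ∀ {C R} w → S λs C R (consecutive α ⊕ consecutive σ) w →
    S λs C R (consecutive β ⊕ consecutive σ) (exchangeRuns w) ×
    flatten (mapRuns (exchange (WilfEquivalent-sym W)) (blocks (Covered? (exchangeRuns w)) (exchangeRuns w))) ≡ w
  transfer {C} {R} w (fill , avoid) =
    (filling′ B valid fill′ avoid′ , avoids′ B valid fill′ avoid′ ∘ β⊕σ.FillContains⇒Contains) ,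
    trans (cong (flatten ∘ mapRuns (exchange (WilfEquivalent-sym W)))
             (blocks-flatten (Covered? (exchangeRuns w)) _ (valid′ B valid fill′ avoid′)))
      (trans (cong flatten (inverse′ B valid fill′ avoid′)) flat)
    where
    B : Blocks
    B = blocks (Covered? w) w
    flat : flatten B ≡ w
    flat = flatten-blocks (Covered? w) w
    valid : Valid (Covered (flatten B)) B
    valid = subst (λ u → Valid (Covered u) B) (sym flat) (Valid-blocks (Covered? w) w)
    fill′ : FillingCR λs C R (flatten B)
    fill′ = subst (FillingCR λs C R) (sym flat) fill
    avoid′ : ¬ α⊕σ.Contains (flatten B)
    avoid′ = avoid ∘ α⊕σ.Contains⇒FillContains ∘ subst α⊕σ.Contains flat

  finite : ∀ C R → ∃ (HasCard (S λs C R (consecutive α ⊕ consecutive σ)))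
  finite C R = enumerate Word-≟
    (λ w → FillingCR? λs C R w ×-dec ¬? (map′ α⊕σ.Contains⇒FillContains α⊕σ.FillContains⇒Contains (α⊕σ.Contains? w)))
    (words (width λs) (height λs)) (λ w (fill , _) → filling∈words young fill)

theorem3p4 : (α β σ : List ℕ) →
    IsPerm (length α) α → 0 < length α →
    IsPerm (length β) β → 0 < length β →
    IsPerm (length σ) σ → 0 < length σ →
    WilfEquivalent (consecutive α) (consecutive β) →
    FSWilfEquivalent (consecutive α ⊕ consecutive σ) (consecutive β ⊕ consecutive σ)
theorem3p4 α β σ permα 0<α permβ 0<β permσ 0<σ W λs young C R _ _ =
  -- Only one side is enumerated; the other inherits its cardinality. The inverse law of `β→α`
  -- mentions `WilfEquivalent-sym` applied twice to `W`, which is definitionally `W`.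
  proj₁ αCard , proj₂ αCard , HasCard-bijection α→β.exchangeRuns β→α.exchangeRuns α→β.transfer β→α.transfer (proj₂ αCard)
  where
  module α→β = Transfer permα 0<α permβ 0<β permσ 0<σ W young
  module β→α = Transfer permβ 0<β permα 0<α permσ 0<σ (WilfEquivalent-sym W) young
  αCard = α→β.finite C R
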